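{- The worst-case performance ratio of the algorithm LP-Round for the Colored Knapsack Problem (ColKP) is exactly $1/3$; that is, $$\inf_{I}\frac{p(\hat S(I))}{\mathrm{OPT}(I)}=\frac13,$$ where the infimum is over all ColKP instances $I$ with $w_i\le b$ and $-p_{\max}<p_i\le p_{\max}$ for all items $i$, and $p_{\max}=\max_i p_i>0$, and $\hat S(I)$ is the solution returned by LP-Round on $I$.
   Context: ColKP instance: items $\mathcal I=\{1,\dots,n\}$, capacity $b\in\mathbb Z_{>0}$, colors $\mathcal C=\{1,\dots,m\}$; each item $i$ has weight $w_i\in\mathbb Z_{>0}$, profit $p_i\in\mathbb Z$ and color $\kappa_i\in\mathcal C$. For $S\subseteq\mathcal I$: $w(S)=\sum_{i\in S}w_i$, $p(S)=\sum_{i\in S}p_i$, $\mathcal I_c=\{i\in\mathcal I:\kappa_i=c\}$, $k_c(S)=|S\cap\mathcal I_c|$, $d(S)=\max_{c\in\mathcal C}k_c(S)$. A color $c$ is dominant in $S$ if $k_c(S)=d(S)$. $S$ is color-feasible if $2d(S)\le|S|+1$, and feasible if moreover $w(S)\le b$. $\mathrm{OPT}(I)=\max\{p(S):S\subseteq\mathcal I\text{ feasible}\}$ (positive under the stated assumptions). $\mathrm{LP_{Col}}$: maximize $\sum_{i\in\mathcal I}p_ix_i$ subject to $\sum_{i\in\mathcal I}w_ix_i\le b$; $\sum_{i\in\mathcal I_c}x_i-\sum_{i\in\mathcal I\setminus\mathcal I_c}x_i\le1$ for all $c\in\mathcal C$; $x_i\in[0,1]$ for all $i\in\mathcal I$.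 Algorithm LP-Round: (1) compute an optimal basic solution $x^*$ (an optimal extreme point) of $\mathrm{LP_{Col}}$; (2) set $S_0=\{i\in\mathcal I:x_i^*=1\}$; (3) if $S_0$ is not color-feasible, let $c$ be its unique dominant color, choose $j\in S_0\cap\mathcal I_c$ of minimum profit, and replace $S_0$ by $S_0\setminus\{j\}$; (4) let $r$ be an item of maximum profit $p_r=p_{\max}$; (5) return as $\hat S$ the more profitable of the two sets $S_0$ and $\{r\}$. Choices among several optimal basic solutions and ties are resolved arbitrarily. -}

module Defs where

open import Algebra.Bundles using (CommutativeMonoid)
import Algebra.Properties.CommutativeMonoid.Sum as Summation
open import Data.Bool.Base using (true; false; if_then_else_)
open import Data.Fin.Base using (Fin; zero; suc)
import Data.Fin.Properties as Fin
open import Data.Fin.Subset using (Subset; inside; outside; _∈_; _∩_; _-_; ∁; ⁅_⁆; ⊥; ∣_∣)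
import Data.Fin.Subset.Properties as Subset
open import Data.Integer.Base as ℤ using (ℤ; +_; 0ℤ)
import Data.Integer.Properties as ℤ
open import Data.List.Base using (List; []; _∷_; _++_; map; filter)
open import Data.List.Extrema ℤ.≤-totalOrder using (argmax; argmax-all; f[xs]≤f[argmax])
import Data.List.Membership.Propositional as List
open import Data.List.Membership.Propositional.Properties
  using (∈-map⁺; ∈-++⁺ˡ; ∈-++⁺ʳ; ∈-filter⁺)
import Data.List.Relation.Unary.All as All
open import Data.List.Relation.Unary.All.Properties using (all-filter)
open import Data.List.Relation.Unary.Any using (here)
open import Data.Nat.Base as ℕ using (ℕ; zero; suc; _⊔_)
import Data.Nat.Properties as ℕ
open import Data.Product.Base using (Σ-syntax; ∃-syntax; _×_; _,_; proj₁)
open import Data.Rational.Base as ℚ using (ℚ; 0ℚ; 1ℚ; _/_)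
import Data.Rational.Properties as ℚ
open import Data.Sum.Base using (_⊎_; inj₁; inj₂)
open import Data.Vec.Base using ([]; _∷_; lookup; tabulate)
open import Data.Vec.Functional using (Vector; foldr)
open import Level using (0ℓ)
open import Relation.Binary.PropositionalEquality
  using (_≡_; _≗_; refl; sym; trans; subst)
open import Relation.Nullary using (¬_; Dec; does)
open import Relation.Nullary.Decidable using (_×-dec_)

module SumOver (M : CommutativeMonoid 0ℓ 0ℓ) where
  open CommutativeMonoid M
    using (Carrier; _≈_; ε; setoid; ∙-congˡ; identityˡ; identityʳ)
    renaming (trans to ≈-trans; refl to ≈-refl)
  open Summation M using (sum)

  sumOver : ∀ {n} → Subset n → Vector Carrier n → Carrier
  sumOver S f = sum (λ i → if lookup S i then f i else ε)

  sumOver-⊥ : ∀ {n} (f : Vector Carrier n) → sumOver ⊥ f ≈ ε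
  sumOver-⊥ {zero}  f = ≈-refl
  sumOver-⊥ {suc n} f = ≈-trans (identityˡ _) (sumOver-⊥ (λ i → f (suc i)))

  sumOver-⁅⁆ : ∀ {n} (r : Fin n) (f : Vector Carrier n) → sumOver ⁅ r ⁆ f ≈ f r
  sumOver-⁅⁆ zero    f = ≈-trans (∙-congˡ (sumOver-⊥ (λ i → f (suc i)))) (identityʳ _)
  sumOver-⁅⁆ (suc r) f = ≈-trans (identityˡ _) (sumOver-⁅⁆ r (λ i → f (suc i)))

open SumOver ℕ.+-0-commutativeMonoid public
  using () renaming (sumOver to sumOverℕ; sumOver-⊥ to sumOverℕ-⊥; sumOver-⁅⁆ to sumOverℕ-⁅⁆)
open SumOver ℤ.+-0-commutativeMonoid public
  using () renaming (sumOver to sumOverℤ; sumOver-⊥ to sumOverℤ-⊥; sumOver-⁅⁆ to sumOverℤ-⁅⁆)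
open SumOver ℚ.+-0-commutativeMonoid public
  using () renaming (sumOver to sumOverℚ; sumOver-⊥ to sumOverℚ-⊥; sumOver-⁅⁆ to sumOverℚ-⁅⁆)
open Summation ℚ.+-0-commutativeMonoid public
  using () renaming (sum to sumℚ)

subsets : ∀ n → List (Subset n)
subsets zero    = [] ∷ []
subsets (suc n) = map (inside ∷_) (subsets n) ++ map (outside ∷_) (subsets n)

subsets-complete : ∀ {n} (S : Subset n) → S List.∈ subsets n
subsets-complete []          = here refl
subsets-complete (true ∷ S)  = ∈-++⁺ˡ (∈-map⁺ (inside ∷_) (subsets-complete S))
subsets-complete (false ∷ S) =
  ∈-++⁺ʳ (map (inside ∷_) (subsets _)) (∈-map⁺ (outside ∷_) (subsets-complete S))

record Instance : Set where
  field
    n m b : ℕ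
    w     : Fin n → ℕ
    p     : Fin n → ℤ
    κ     : Fin n → Fin m
    b>0   : 0 ℕ.< b
    w>0   : ∀ i → 0 ℕ.< w i

module ColKP (I : Instance) where
  open Instance I public

  weight : Subset n → ℕ
  weight S = sumOverℕ S w

  profit : Subset n → ℤ
  profit S = sumOverℤ S p

  items : Fin m → Subset n
  items c = tabulate (λ i → does (κ i Fin.≟ c))

  k : Subset n → Fin m → ℕ
  k S c = ∣ S ∩ items c ∣

  d : Subset n → ℕ
  d S = foldr _⊔_ 0 (k S)

  Dominant : Subset n → Fin m → Set
  Dominant S c = k S c ≡ d S

  ColorFeasible : Subset n → Set
  ColorFeasible S = 2 ℕ.* d S ℕ.≤ ∣ S ∣ ℕ.+ 1

  Feasible : Subset n → Set
  Feasible S = ColorFeasible S × weight S ℕ.≤ b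

  feasible? : (S : Subset n) → Dec (Feasible S)
  feasible? S = (_ ℕ.≤? _) ×-dec (_ ℕ.≤? _)

  -- The default value ∅ of argmax is itself feasible, so OPT is the maximum
  -- of the profit over exactly the feasible sets (OPT-attained, OPT-upper).
  optimalSet : Subset n
  optimalSet = argmax profit ⊥ (filter feasible? (subsets n))

  OPT : ℤ
  OPT = profit optimalSet

  record LPFeasible (x : Fin n → ℚ) : Set where
    field
      capacity : sumℚ (λ i → (+ w i / 1) ℚ.* x i) ℚ.≤ + b / 1
      color    : ∀ c → sumOverℚ (items c) x ℚ.- sumOverℚ (∁ (items c)) x ℚ.≤ 1ℚ
      nonneg   : ∀ i → 0ℚ ℚ.≤ x i
      atMost1  : ∀ i → x i ℚ.≤ 1ℚ

  lpValue : (Fin n → ℚ) → ℚ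
  lpValue x = sumℚ (λ i → (p i / 1) ℚ.* x i)

  LPOptimal : (Fin n → ℚ) → Set
  LPOptimal x = LPFeasible x × (∀ y → LPFeasible y → lpValue y ℚ.≤ lpValue x)

  -- The data are rational, hence so are all extreme points of the real
  -- polytope, and they are exactly the extreme points of its rational part.
  LPExtreme : (Fin n → ℚ) → Set
  LPExtreme x = LPFeasible x ×
    (∀ y z t → LPFeasible y → LPFeasible z → 0ℚ ℚ.< t → t ℚ.< 1ℚ →
     x ≗ (λ i → t ℚ.* y i ℚ.+ (1ℚ ℚ.- t) ℚ.* z i) → y ≗ z)

  ones : (Fin n → ℚ) → Subset n
  ones x = tabulate (λ i → does (x i ℚ.≟ 1ℚ))

  data Repair (S₀ : Subset n) : Subset n → Set where
    keep   : ColorFeasible S₀ → Repair S₀ S₀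
    remove : ∀ c j → ¬ ColorFeasible S₀ → Dominant S₀ c →
             j ∈ S₀ ∩ items c → (∀ i → i ∈ S₀ ∩ items c → p j ℤ.≤ p i) →
             Repair S₀ (S₀ - j)

  MoreProfitableOf : Subset n → Subset n → Subset n → Set
  MoreProfitableOf S T Ŝ =
    (Ŝ ≡ S × profit T ℤ.≤ profit S) ⊎ (Ŝ ≡ T × profit S ℤ.≤ profit T)

  -- LP-Round is nondeterministic, so it is given as the relation
  -- "Ŝ is returned by some run".
  record LPRound (Ŝ : Subset n) : Set where
    field
      x*       : Fin n → ℚ
      optimal  : LPOptimal x*
      basic    : LPExtreme x*
      S₀       : Subset n
      rounded  : Repair (ones x*) S₀
      r        : Fin n
      r-max    : ∀ i → p i ℤ.≤ p r
      returned : MoreProfitableOf S₀ ⁅ r ⁆ Ŝ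

  record Admissible : Set where
    field
      pmax      : ℤ
      attained  : ∃[ i ] p i ≡ pmax
      p≤pmax    : ∀ i → p i ℤ.≤ pmax
      pmax>0    : 0ℤ ℤ.< pmax
      -pmax<p   : ∀ i → ℤ.- pmax ℤ.< p i
      w≤b       : ∀ i → w i ℕ.≤ b

  d-least : ∀ S v → (∀ c → k S c ℕ.≤ v) → d S ℕ.≤ v
  d-least S v = go (k S)
    where
    go : ∀ {l} (f : Vector ℕ l) → (∀ c → f c ℕ.≤ v) → foldr _⊔_ 0 f ℕ.≤ v
    go {zero}  f f≤v = ℕ.z≤n
    go {suc l} f f≤v = ℕ.⊔-lub (f≤v zero) (go (λ c → f (suc c)) (λ c → f≤v (suc c)))

  d≤∣S∣ : ∀ S → d S ℕ.≤ ∣ S ∣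
  d≤∣S∣ S = d-least S ∣ S ∣ (λ c → Subset.p⊆q⇒∣p∣≤∣q∣ (Subset.p∩q⊆p S (items c)))

  ∅-feasible : Feasible ⊥
  ∅-feasible =
      ℕ.≤-trans (ℕ.*-monoʳ-≤ 2 (subst (d ⊥ ℕ.≤_) (Subset.∣⊥∣≡0 n) (d≤∣S∣ ⊥))) ℕ.z≤n
    , subst (ℕ._≤ b) (sym (sumOverℕ-⊥ w)) ℕ.z≤n

  singleton-feasible : ∀ r → w r ℕ.≤ b → Feasible ⁅ r ⁆
  singleton-feasible r wr≤b =
      subst (λ s → 2 ℕ.* d ⁅ r ⁆ ℕ.≤ s ℕ.+ 1) (sym ∣r∣≡1)
        (ℕ.*-monoʳ-≤ 2 (subst (d ⁅ r ⁆ ℕ.≤_) ∣r∣≡1 (d≤∣S∣ ⁅ r ⁆)))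
    , subst (ℕ._≤ b) (sym (sumOverℕ-⁅⁆ r w)) wr≤b
    where
    ∣r∣≡1 : ∣ ⁅ r ⁆ ∣ ≡ 1
    ∣r∣≡1 = Subset.∣⁅x⁆∣≡1 r

  OPT-attained : Feasible optimalSet
  OPT-attained = argmax-all profit ∅-feasible (all-filter feasible? (subsets n))

  OPT-upper : ∀ S → Feasible S → profit S ℤ.≤ OPT
  OPT-upper S feas =
    All.lookup (f[xs]≤f[argmax] ⊥ (filter feasible? (subsets n)))
      (∈-filter⁺ feasible? (subsets-complete S) feas)

  OPT>0 : Admissible → 0ℤ ℤ.< OPT
  OPT>0 adm with Admissible.attained adm
  ... | r , pr≡pmax =
    ℤ.<-≤-trans
      (subst (0ℤ ℤ.<_) (sym (trans (sumOverℤ-⁅⁆ r p) pr≡pmax)) (Admissible.pmax>0 adm))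
      (OPT-upper ⁅ r ⁆ (singleton-feasible r (Admissible.w≤b adm r)))

  -- OPT is positive, so ∣ OPT ∣ is just OPT as a natural number.
  ratio : Admissible → Subset n → ℚ
  ratio adm Ŝ = _/_ (profit Ŝ) ℤ.∣ OPT ∣ {{ℤ.≢-nonZero (λ OPT≡0 → ℤ.<⇒≢ (OPT>0 adm) (sym OPT≡0))}}

AdmissibleInstance : Set
AdmissibleInstance = Σ[ I ∈ Instance ] ColKP.Admissible I

-- A tie-breaking rule fixed in advance: every instance gets one output of LP-Round.
LPRoundRule : Set
LPRoundRule =
  ((I , _) : AdmissibleInstance) → ∃[ Ŝ ] ColKP.LPRound I Ŝ

-- The ratios realised by all runs of LP-Round, over all tie-breakings.
RunRatio : ℚ → Set
RunRatio q =
  Σ[ (I , adm) ∈ AdmissibleInstance ] Σ[ Ŝ ∈ Subset (Instance.n I) ]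
    ColKP.LPRound I Ŝ × ColKP.ratio I adm Ŝ ≡ q

RuleRatio : LPRoundRule → ℚ → Set
RuleRatio A q =
  Σ[ J@(I , adm) ∈ AdmissibleInstance ] ColKP.ratio I adm (proj₁ (A J)) ≡ q

-- For rational q the ε-form of "greatest" lower bound makes q the infimum in ℝ
-- as well as in ℚ.
IsInfimum : (ℚ → Set) → ℚ → Set
IsInfimum P q =
  (∀ x → P x → q ℚ.≤ x) ×
  (∀ ε → 0ℚ ℚ.< ε → ∃[ x ] P x × x ℚ.< q ℚ.+ ε)

{-# OPTIONS --safe #-}
module Submission where

-- Lower bound.  At an extreme point x of the LP at most one colour constraint
-- is tight (two of them add up to something ≤ 0), so capacity and that
-- constraint leave at most two fractional items: with three, the cross product
-- of the two constraint rows would be a direction in which x moves both ways.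
-- Without a removal, OPT ≤ LP ≤ p(S₀) + 2 pmax.  If an item j is removed, then
-- the two fractional values add up to at most 1, so p_j and the fractional items
-- again contribute at most 2 pmax.
--
-- Upper bound.  With profits N, N, N, N - 1, weights 1, 1, 2N + 2, 2N, colours
-- 0, 0, 1, 1 and capacity 2N + 3, the unique LP optimum is (1, 1, ½, ½).  The
-- removal leaves profit N, whereas {0, 1, 3} is feasible with profit 3N - 1.

open import Defs
open import Algebra.Bundles using (CommutativeRing)
import Algebra.Properties.CommutativeSemigroup as CommutativeSemigroup
import Algebra.Properties.Semiring.Sum as SemiringSum
open import Data.Bool.Base using (true; false; if_then_else_)
open import Data.Empty using (⊥-elim)
open import Data.Fin.Base using (Fin; zero; suc)
open import Data.Fin.Patterns using (0F; 1F; 2F; 3F)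
import Data.Fin.Properties as Fin
open import Data.Fin.Subset using (Subset; inside; outside; ⁅_⁆; _∩_; _-_; _∈_; ∁; ∣_∣)
import Data.Fin.Subset.Properties as Subset
open import Data.Integer.Base as ℤ using (ℤ; +_)
import Data.Integer.Properties as ℤ
open import Data.Nat.Base as ℕ using (ℕ; zero; suc)
import Data.Nat.Coprimality as Coprime
import Data.Nat.Properties as ℕ
open import Data.Product.Base using (_×_; ∃-syntax; _,_; proj₁; proj₂)
open import Data.Rational.Base as ℚ using (ℚ; mkℚ; 0ℚ; 1ℚ; ½; _/_; _+_; _*_; -_; _≤_; _<_)
import Data.Rational.Properties as ℚ
open import Data.Rational.Solver using (module +-*-Solver)
import Data.Rational.Unnormalised.Base as ℚᵘ
import Data.Rational.Unnormalised.Properties as ℚᵘ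
open import Data.Sum.Base using (_⊎_; inj₁; inj₂)
open import Data.Vec.Base using ([]; _∷_; lookup; here; there)
open import Data.Vec.Functional using (Vector; foldr)
open import Data.Vec.Properties using (lookup∘tabulate; tabulate-cong)
open import Function.Base using (_∘_)
open import Relation.Binary.PropositionalEquality
  using (_≡_; _≢_; _≗_; refl; sym; trans; cong; cong₂; subst; subst₂; module ≡-Reasoning)
open import Relation.Nullary using (¬_; Dec; does; yes; no; ¬?; contradiction)
open import Relation.Nullary.Decidable using (_×-dec_; _⊎-dec_; from-yes; from-no)
open import Relation.Unary using (Decidable)

open SemiringSum (CommutativeRing.semiring ℚ.+-*-commutativeRing)
  using (sum-cong-≗; ∑-distrib-+; *-distribˡ-sum; sum-replicate-zero)
open +-*-Solver using (solve; con; _:+_; _:*_; _:-_; :-_; _:=_)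

-- The name _-_ is taken by the removal of an element from a subset.
infixl 6 _⊖_
_⊖_ : ℚ → ℚ → ℚ
_⊖_ = ℚ._-_

-- Ordered-field arithmetic by certificates: below, an inequality p ≤ q is proved by
-- exhibiting q - p as a sum of products of nonnegative terms.

0≤q-p : ∀ {p q} → p ≤ q → 0ℚ ≤ q ⊖ p
0≤q-p {p} {q} p≤q = subst (_≤ q ⊖ p) (ℚ.+-inverseʳ p) (ℚ.+-monoˡ-≤ (- p) p≤q)

0<q-p : ∀ {p q} → p < q → 0ℚ < q ⊖ p
0<q-p {p} {q} p<q = subst (_< q ⊖ p) (ℚ.+-inverseʳ p) (ℚ.+-monoˡ-< (- p) p<q)

p+[q-p]≡q : ∀ p q → p + (q ⊖ p) ≡ q
p+[q-p]≡q = solve 2 (λ p q → p :+ (q :- p) := q) refl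

≤-certificate : ∀ {p q r} → q ⊖ p ≡ r → 0ℚ ≤ r → p ≤ q
≤-certificate {p} {q} refl 0≤r =
  subst₂ _≤_ (ℚ.+-identityʳ p) (p+[q-p]≡q p q) (ℚ.+-monoʳ-≤ p 0≤r)

<-certificate : ∀ {p q r} → q ⊖ p ≡ r → 0ℚ < r → p < q
<-certificate {p} {q} refl 0<r =
  subst₂ _<_ (ℚ.+-identityʳ p) (p+[q-p]≡q p q) (ℚ.+-monoʳ-< p 0<r)

0≤+ : ∀ {p q} → 0ℚ ≤ p → 0ℚ ≤ q → 0ℚ ≤ p + q
0≤+ = ℚ.+-mono-≤

0<+ : ∀ {p q} → 0ℚ < p → 0ℚ ≤ q → 0ℚ < p + q
0<+ = ℚ.+-mono-<-≤

0≤* : ∀ {p q} → 0ℚ ≤ p → 0ℚ ≤ q → 0ℚ ≤ p * q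
0≤* {p} {q} 0≤p 0≤q =
  ℚ.nonNegative⁻¹ (p * q)
    {{ℚ.nonNeg*nonNeg⇒nonNeg p {{ℚ.nonNegative 0≤p}} q {{ℚ.nonNegative 0≤q}}}}

0<* : ∀ {p q} → 0ℚ < p → 0ℚ < q → 0ℚ < p * q
0<* {p} {q} 0<p 0<q =
  ℚ.positive⁻¹ (p * q) {{ℚ.pos*pos⇒pos p {{ℚ.positive 0<p}} q {{ℚ.positive 0<q}}}}

0<1 : 0ℚ < 1ℚ
0<1 = ℚ.*<* (ℤ.+<+ (ℕ.s≤s ℕ.z≤n))

≢∧≤⇒< : ∀ {p q} → p ≢ q → p ≤ q → p < q
≢∧≤⇒< {p} {q} p≢q p≤q with p ℚ.<? q
... | yes p<q = p<q
... | no  p≮q = ⊥-elim (p≢q (ℚ.≤-antisym p≤q (ℚ.≮⇒≥ p≮q)))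

*-zero-cancelˡ : ∀ {p q} → p ≢ 0ℚ → p * q ≡ 0ℚ → q ≡ 0ℚ
*-zero-cancelˡ {p} {q} p≢0 pq≡0 = begin
  q                    ≡⟨ sym (ℚ.*-identityˡ q) ⟩
  1ℚ * q               ≡⟨ cong (_* q) (sym (ℚ.*-inverseˡ p)) ⟩
  ℚ.1/ p * p * q       ≡⟨ ℚ.*-assoc (ℚ.1/ p) p q ⟩
  ℚ.1/ p * (p * q)     ≡⟨ cong (ℚ.1/ p *_) pq≡0 ⟩
  ℚ.1/ p * 0ℚ          ≡⟨ ℚ.*-zeroʳ (ℚ.1/ p) ⟩
  0ℚ                   ∎
  where
  open ≡-Reasoning
  instance
    p-nonZero : ℚ.NonZero p
    p-nonZero = ℚ.≢-nonZero p≢0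

-- Embedding of the integers into the rationals

ι : ℤ → ℚ
ι z = z / 1

-- The quotient `z / 1` is a normalisation that is stuck for a variable `z`. Rewriting it to an
-- explicit fraction with denominator 1 lets sums, products and comparisons compute.
ι≡mkℚ : ∀ z → ι z ≡ mkℚ z 0 (Coprime.sym (Coprime.1-coprimeTo ℤ.∣ z ∣))
ι≡mkℚ z = ℚ.↥p/↧p≡p (mkℚ z 0 (Coprime.sym (Coprime.1-coprimeTo ℤ.∣ z ∣)))

ι-+ : ∀ y z → ι (y ℤ.+ z) ≡ ι y + ι z
ι-+ y z rewrite ι≡mkℚ y | ι≡mkℚ z =
  cong ι (sym (cong₂ ℤ._+_ (ℤ.*-identityʳ y) (ℤ.*-identityʳ z)))

ι-* : ∀ y z → ι (y ℤ.* z) ≡ ι y * ι z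
ι-* y z rewrite ι≡mkℚ y | ι≡mkℚ z = refl

ι-mono-≤ : ∀ {y z} → y ℤ.≤ z → ι y ≤ ι z
ι-mono-≤ {y} {z} y≤z rewrite ι≡mkℚ y | ι≡mkℚ z =
  ℚ.*≤* (ℤ.*-monoʳ-≤-nonNeg (+ 1) y≤z)

ι-mono-< : ∀ {y z} → y ℤ.< z → ι y < ι z
ι-mono-< {y} {z} y<z rewrite ι≡mkℚ y | ι≡mkℚ z =
  ℚ.*<* (ℤ.*-monoʳ-<-pos (+ 1) y<z)

ι-cancel-≤ : ∀ {y z} → ι y ≤ ι z → y ℤ.≤ z
ι-cancel-≤ {y} {z} ιy≤ιz with y ℤ.≤? z
... | yes y≤z = y≤z
... | no  y≰z = ⊥-elim (ℚ.<-irrefl refl (ℚ.<-≤-trans (ι-mono-< (ℤ.≰⇒> y≰z)) ιy≤ιz))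

ι-cancel-< : ∀ {y z} → ι y < ι z → y ℤ.< z
ι-cancel-< {y} {z} ιy<ιz with y ℤ.<? z
... | yes y<z = y<z
... | no  y≮z = ⊥-elim (ℚ.<-irrefl refl (ℚ.<-≤-trans ιy<ιz (ι-mono-≤ (ℤ.≮⇒≥ y≮z))))

-- Dot products and vectors with one nonzero entry

infix 7 _·_
_·_ : ∀ {n} → Vector ℚ n → Vector ℚ n → ℚ
f · g = sumℚ (λ i → f i * g i)

·-congʳ : ∀ {n} (f : Vector ℚ n) {g h : Vector ℚ n} → g ≗ h → f · g ≡ f · h
·-congʳ f g≗h = sum-cong-≗ (λ i → cong (f i *_) (g≗h i))

·-+ : ∀ {n} (f g h : Vector ℚ n) → f · (λ i → g i + h i) ≡ f · g + f · h
·-+ f g h =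
  trans (sum-cong-≗ (λ i → ℚ.*-distribˡ-+ (f i) (g i) (h i)))
        (∑-distrib-+ (λ i → f i * g i) (λ i → f i * h i))

·-* : ∀ {n} (f : Vector ℚ n) t h → f · (λ i → t * h i) ≡ t * (f · h)
·-* f t h =
  trans (sum-cong-≗ (λ i → solve 3 (λ a t b → a :* (t :* b) := t :* (a :* b)) refl (f i) t (h i)))
        (sym (*-distribˡ-sum t (λ i → f i * h i)))

single : ∀ {n} → Fin n → ℚ → Vector ℚ n
single i q j = if does (j Fin.≟ i) then q else 0ℚ

single-≡ : ∀ {n} (i : Fin n) q → single i q i ≡ q
single-≡ i q with i Fin.≟ i
... | yes _  = refl
... | no i≢i = ⊥-elim (i≢i refl)

single-≢ : ∀ {n} {i j : Fin n} q → j ≢ i → single i q j ≡ 0ℚ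
single-≢ {i = i} {j} q j≢i with j Fin.≟ i
... | yes j≡i = ⊥-elim (j≢i j≡i)
... | no _    = refl

·-0 : ∀ {n} (f : Vector ℚ n) {g : Vector ℚ n} → (∀ i → g i ≡ 0ℚ) → f · g ≡ 0ℚ
·-0 {n} f g≡0 = trans (sum-cong-≗ (λ i → trans (cong (f i *_) (g≡0 i)) (ℚ.*-zeroʳ (f i))))
                  (sum-replicate-zero n)

·-single : ∀ {n} (f : Vector ℚ n) i q → f · single i q ≡ f i * q
·-single f zero    q = trans (cong (λ s → f zero * q + s) (·-0 (f ∘ suc) (λ _ → refl))) (ℚ.+-identityʳ _)
·-single f (suc i) q =
  trans (cong₂ _+_ (ℚ.*-zeroʳ (f zero)) (trans (·-congʳ (f ∘ suc) pre) (·-single (f ∘ suc) i q)))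
        (ℚ.+-identityˡ _)
  where
  pre : ∀ j → single (suc i) q (suc j) ≡ single i q j
  pre j with j Fin.≟ i
  ... | yes _ = refl
  ... | no  _ = refl

sum-nonPos : ∀ {n} (f : Vector ℚ n) → (∀ i → f i ≤ 0ℚ) → sumℚ f ≤ 0ℚ
sum-nonPos {zero}  f f≤0 = ℚ.≤-refl
sum-nonPos {suc n} f f≤0 = ℚ.+-mono-≤ (f≤0 zero) (sum-nonPos (f ∘ suc) (f≤0 ∘ suc))

-- Indicator vectors and colour constraints as rows of signs

χ : ∀ {n} → Subset n → Vector ℚ n
χ S i = if lookup S i then 1ℚ else 0ℚ

σ : ∀ {n} → Subset n → Vector ℚ n
σ T i = if lookup T i then 1ℚ else - 1ℚ

-- Turns a colour constraint into a single linear row with entries 1 and -1, so that it can be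
-- treated by dot products like the capacity.
sumOver-∁ : ∀ {n} (T : Subset n) x → sumOverℚ T x ⊖ sumOverℚ (∁ T) x ≡ σ T · x
sumOver-∁ []          x = refl
sumOver-∁ (true ∷ T)  x = trans
  (solve 3 (λ a p q → (a :+ p) :- (con 0ℚ :+ q) := con 1ℚ :* a :+ (p :- q)) refl
    (x zero) (sumOverℚ T (x ∘ suc)) (sumOverℚ (∁ T) (x ∘ suc)))
  (cong (λ s → 1ℚ * x zero + s) (sumOver-∁ T (x ∘ suc)))
sumOver-∁ (false ∷ T) x = trans
  (solve 3 (λ a p q → (con 0ℚ :+ p) :- (a :+ q) := con (- 1ℚ) :* a :+ (p :- q)) refl
    (x zero) (sumOverℚ T (x ∘ suc)) (sumOverℚ (∁ T) (x ∘ suc)))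
  (cong (λ s → - 1ℚ * x zero + s) (sumOver-∁ T (x ∘ suc)))

ι-suc : ∀ m → ι (+ suc m) ≡ 1ℚ + ι (+ m)
ι-suc m = ι-+ (+ 1) (+ m)

-- At a 0/1 point the colour row is an integer, and requiring it to be at most 1 is the
-- combinatorial condition `2 k ≤ |S| + 1`.
σ·χ : ∀ {n} (T S : Subset n) →
      σ T · χ S ≡ ι (+ ∣ S ∩ T ∣) + ι (+ ∣ S ∩ T ∣) ⊖ ι (+ ∣ S ∣)
σ·χ []      []          = refl
σ·χ (t ∷ T) (false ∷ S) = trans (cong₂ _+_ (ℚ.*-zeroʳ (σ (t ∷ T) zero)) (σ·χ T S)) (ℚ.+-identityˡ _)
σ·χ (true ∷ T) (true ∷ S) = begin
  1ℚ * 1ℚ + σ T · χ S                   ≡⟨ cong (λ q → 1ℚ * 1ℚ + q) (σ·χ T S) ⟩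
  1ℚ * 1ℚ + (k + k ⊖ s)                 ≡⟨ solve 2 (λ k s → con 1ℚ :* con 1ℚ :+ (k :+ k :- s) :=
                                             (con 1ℚ :+ k) :+ (con 1ℚ :+ k) :- (con 1ℚ :+ s)) refl k s ⟩
  (1ℚ + k) + (1ℚ + k) ⊖ (1ℚ + s)        ≡⟨ sym (cong₂ (λ k s → k + k ⊖ s) (ι-suc ∣ S ∩ T ∣) (ι-suc ∣ S ∣)) ⟩
  ι (+ suc ∣ S ∩ T ∣) + ι (+ suc ∣ S ∩ T ∣) ⊖ ι (+ suc ∣ S ∣) ∎
  where
  open ≡-Reasoning
  k = ι (+ ∣ S ∩ T ∣)
  s = ι (+ ∣ S ∣)
σ·χ (false ∷ T) (true ∷ S) = begin
  - 1ℚ * 1ℚ + σ T · χ S                 ≡⟨ cong (λ q → - 1ℚ * 1ℚ + q) (σ·χ T S) ⟩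
  - 1ℚ * 1ℚ + (k + k ⊖ s)               ≡⟨ solve 2 (λ k s → con (- 1ℚ) :* con 1ℚ :+ (k :+ k :- s) :=
                                             k :+ k :- (con 1ℚ :+ s)) refl k s ⟩
  k + k ⊖ (1ℚ + s)                      ≡⟨ sym (cong (λ s → k + k ⊖ s) (ι-suc ∣ S ∣)) ⟩
  k + k ⊖ ι (+ suc ∣ S ∣)               ∎
  where
  open ≡-Reasoning
  k = ι (+ ∣ S ∩ T ∣)
  s = ι (+ ∣ S ∣)

·χ : ∀ {n} (f : Vector ℚ n) S → f · χ S ≡ sumOverℚ S f
·χ f []          = refl
·χ f (true ∷ S)  = cong₂ _+_ (ℚ.*-identityʳ (f zero)) (·χ (f ∘ suc) S)
·χ f (false ∷ S) = cong₂ _+_ (ℚ.*-zeroʳ (f zero)) (·χ (f ∘ suc) S)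

ι-sumOverℕ : ∀ {n} (S : Subset n) w → ι (+ sumOverℕ S w) ≡ sumOverℚ S (λ i → ι (+ w i))
ι-sumOverℕ []          w = refl
ι-sumOverℕ (true ∷ S)  w =
  trans (ι-+ (+ w zero) (+ sumOverℕ S (w ∘ suc)))
        (cong (λ s → ι (+ w zero) + s) (ι-sumOverℕ S (w ∘ suc)))
ι-sumOverℕ (false ∷ S) w =
  trans (ι-+ (+ 0) (+ sumOverℕ S (w ∘ suc)))
        (cong (λ s → 0ℚ + s) (ι-sumOverℕ S (w ∘ suc)))

ι-sumOverℤ : ∀ {n} (S : Subset n) p → ι (sumOverℤ S p) ≡ sumOverℚ S (λ i → ι (p i))
ι-sumOverℤ []          p = refl
ι-sumOverℤ (true ∷ S)  p =
  trans (ι-+ (p zero) (sumOverℤ S (p ∘ suc)))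
        (cong (λ s → ι (p zero) + s) (ι-sumOverℤ S (p ∘ suc)))
ι-sumOverℤ (false ∷ S) p =
  trans (ι-+ (+ 0) (sumOverℤ S (p ∘ suc)))
        (cong (λ s → 0ℚ + s) (ι-sumOverℤ S (p ∘ suc)))

sumOverℤ-remove : ∀ {n} {S : Subset n} {j} (p : Vector ℤ n) → j ∈ S →
                  sumOverℤ S p ≡ p j ℤ.+ sumOverℤ (S - j) p
sumOverℤ-remove {S = true ∷ S} {zero} p here =
  cong (λ s → p zero ℤ.+ s)
    (sym (trans (ℤ.+-identityˡ _) (cong (λ T → sumOverℤ T (p ∘ suc)) (Subset.p─⊥≡p S))))
sumOverℤ-remove {S = s ∷ S} {suc j} p (there j∈S) =
  trans (cong (λ r → a ℤ.+ r) (sumOverℤ-remove (p ∘ suc) j∈S))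
        (x∙yz≈y∙xz a (p (suc j)) (sumOverℤ (S - j) (p ∘ suc)))
  where
  open CommutativeSemigroup ℤ.+-commutativeSemigroup using (x∙yz≈y∙xz)
  a = if s then p zero else ℤ.0ℤ

-- Step lengths along a direction, with slacks `g` used up at rates `f`

StepBound : ∀ {k} (f g : Vector ℚ k) → ℚ → Set
StepBound f g ε = ∀ i δ → 0ℚ ≤ δ → δ ≤ ε → δ * f i ≤ g i

-- If `f ≤ 0` the slack does not shrink and any step is allowed. Otherwise `g` cannot vanish, and
-- the quotient of `g` by `f` is a positive step.
stepBound₁ : ∀ f g → 0ℚ ≤ g → (g ≡ 0ℚ → f ≡ 0ℚ) →
             ∃[ ε ] 0ℚ < ε × (∀ δ → 0ℚ ≤ δ → δ ≤ ε → δ * f ≤ g)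
stepBound₁ f g 0≤g g≡0⇒f≡0 with f ℚ.≤? 0ℚ
... | yes f≤0 = 1ℚ , 0<1 , λ δ 0≤δ _ →
  ≤-certificate (solve 3 (λ δ f g → g :- δ :* f := g :+ δ :* (con 0ℚ :- f)) refl δ f g)
    (0≤+ 0≤g (0≤* 0≤δ (0≤q-p f≤0)))
... | no f≰0 = g * ℚ.1/ f , 0<* 0<g (ℚ.positive⁻¹ (ℚ.1/ f)) , λ δ 0≤δ δ≤g/f →
  subst (δ * f ≤_) g/f*f≡g (ℚ.*-monoʳ-≤-nonNeg f δ≤g/f)
  where
  0<f : 0ℚ < f
  0<f = ℚ.≰⇒> f≰0
  instance
    f-pos : ℚ.Positive f
    f-pos = ℚ.positive 0<f
    f-nonNeg : ℚ.NonNegative f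
    f-nonNeg = ℚ.pos⇒nonNeg f
    f-nonZero : ℚ.NonZero f
    f-nonZero = ℚ.pos⇒nonZero f
    1/f-pos : ℚ.Positive (ℚ.1/ f)
    1/f-pos = ℚ.1/pos⇒pos f
  0<g : 0ℚ < g
  0<g = ≢∧≤⇒< (λ 0≡g → ℚ.<⇒≢ 0<f (sym (g≡0⇒f≡0 (sym 0≡g)))) 0≤g
  g/f*f≡g : g * ℚ.1/ f * f ≡ g
  g/f*f≡g = trans (ℚ.*-assoc g (ℚ.1/ f) f)
                  (trans (cong (g *_) (ℚ.*-inverseˡ f)) (ℚ.*-identityʳ g))

0<⊓ : ∀ {p q} → 0ℚ < p → 0ℚ < q → 0ℚ < p ℚ.⊓ q
0<⊓ {p} {q} 0<p 0<q with ℚ.⊓-sel p q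
... | inj₁ p⊓q≡p = subst (0ℚ <_) (sym p⊓q≡p) 0<p
... | inj₂ p⊓q≡q = subst (0ℚ <_) (sym p⊓q≡q) 0<q

stepBound : ∀ {k} (f g : Vector ℚ k) → (∀ i → 0ℚ ≤ g i) → (∀ i → g i ≡ 0ℚ → f i ≡ 0ℚ) →
            ∃[ ε ] 0ℚ < ε × StepBound f g ε
stepBound {zero}  f g _ _ = 1ℚ , 0<1 , λ ()
stepBound {suc k} f g 0≤g g≡0⇒f≡0
  with stepBound₁ (f zero) (g zero) (0≤g zero) (g≡0⇒f≡0 zero)
     | stepBound (f ∘ suc) (g ∘ suc) (0≤g ∘ suc) (g≡0⇒f≡0 ∘ suc)
... | ε₁ , 0<ε₁ , bound₁ | ε₂ , 0<ε₂ , bound₂ = ε₁ ℚ.⊓ ε₂ , 0<⊓ 0<ε₁ 0<ε₂ , λ where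
  zero    δ 0≤δ δ≤ε → bound₁ δ 0≤δ (ℚ.≤-trans δ≤ε (ℚ.p⊓q≤p ε₁ ε₂))
  (suc i) δ 0≤δ δ≤ε → bound₂ i δ 0≤δ (ℚ.≤-trans δ≤ε (ℚ.p⊓q≤q ε₁ ε₂))

p-q≡0⇒q≡p : ∀ {p q} → p ⊖ q ≡ 0ℚ → q ≡ p
p-q≡0⇒q≡p {p} {q} p-q≡0 =
  trans (sym (ℚ.+-identityʳ q)) (trans (cong (λ r → q + r) (sym p-q≡0)) (p+[q-p]≡q q p))

-- Two-sided directions and extreme points of the LP

module LP (I : Instance) where
  open ColKP I

  wℚ pℚ : Vector ℚ n
  wℚ i = ι (+ w i)
  pℚ i = ι (p i)

  sgn : Fin m → Vector ℚ n
  sgn c = σ (items c)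

  color≤ : ∀ {x} → LPFeasible x → ∀ c → sgn c · x ≤ 1ℚ
  color≤ {x} x-feas c = subst (_≤ 1ℚ) (sumOver-∁ (items c) x) (LPFeasible.color x-feas c)

  Integral : ℚ → Set
  Integral q = q ≡ 0ℚ ⊎ q ≡ 1ℚ

  -- A direction along which a feasible x can be moved both ways for some time.
  record Direction (x v : Vector ℚ n) : Set where
    field
      integral : ∀ i → Integral (x i) → v i ≡ 0ℚ
      capacity : wℚ · v ≡ 0ℚ
      color    : ∀ c → sgn c · x ≡ 1ℚ → sgn c · v ≡ 0ℚ

  move : Vector ℚ n → ℚ → Vector ℚ n → Vector ℚ n
  move x δ v i = x i + δ * v i

  ·-move : ∀ f x δ v → f · move x δ v ≡ f · x + δ * (f · v)
  ·-move f x δ v = trans (·-+ f x (λ i → δ * v i)) (cong (λ q → f · x + q) (·-* f δ v))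

  opposite : ∀ {x v} → Direction x v → Direction x (λ i → - 1ℚ * v i)
  opposite {x} {v} dir = record
    { integral = λ i x-int → vanish (integral i x-int)
    ; capacity = trans (·-* wℚ (- 1ℚ) v) (vanish capacity)
    ; color    = λ c tight → trans (·-* (sgn c) (- 1ℚ) v) (vanish (color c tight))
    }
    where
    open Direction dir
    vanish : ∀ {q} → q ≡ 0ℚ → - 1ℚ * q ≡ 0ℚ
    vanish refl = refl

  -- The load does not change along `v`. Lower bounds, upper bounds and colour constraints each
  -- admit a positive step, because the rate is 0 wherever the slack is 0; the minimum of the three
  -- steps serves.
  move-feasible : ∀ {x v} → LPFeasible x → Direction x v →
                  ∃[ ε ] 0ℚ < ε × (∀ δ → 0ℚ ≤ δ → δ ≤ ε → LPFeasible (move x δ v))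
  move-feasible {x} {v} x-feas dir = combine
    (stepBound (λ i → - v i) x nonneg (λ i x≡0 → cong -_ (integral i (inj₁ x≡0))))
    (stepBound v (λ i → 1ℚ ⊖ x i) (λ i → 0≤q-p (atMost1 i))
      (λ i 1-x≡0 → integral i (inj₂ (p-q≡0⇒q≡p 1-x≡0))))
    (stepBound (λ c → sgn c · v) (λ c → 1ℚ ⊖ sgn c · x) (λ c → 0≤q-p (color≤ x-feas c))
      (λ c 1-ax≡0 → Direction.color dir c (p-q≡0⇒q≡p 1-ax≡0)))
    where
    open LPFeasible x-feas using (nonneg; atMost1)
    open Direction dir using (integral)

    capacity-unchanged : ∀ δ → wℚ · move x δ v ≡ wℚ · x
    capacity-unchanged δ = trans (·-move wℚ x δ v)
      (trans (cong (λ q → wℚ · x + δ * q) (Direction.capacity dir))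
             (solve 2 (λ a δ → a :+ δ :* con 0ℚ := a) refl (wℚ · x) δ))

    color-slack : ∀ δ c → 1ℚ ⊖ sgn c · move x δ v ≡ (1ℚ ⊖ sgn c · x) ⊖ δ * (sgn c · v)
    color-slack δ c = trans (cong (λ q → 1ℚ ⊖ q) (·-move (sgn c) x δ v))
      (solve 3 (λ a δ e → con 1ℚ :- (a :+ δ :* e) := (con 1ℚ :- a) :- δ :* e) refl
        (sgn c · x) δ (sgn c · v))

    combine : ∃[ ε ] 0ℚ < ε × StepBound (λ i → - v i) x ε →
              ∃[ ε ] 0ℚ < ε × StepBound v (λ i → 1ℚ ⊖ x i) ε →
              ∃[ ε ] 0ℚ < ε × StepBound (λ c → sgn c · v) (λ c → 1ℚ ⊖ sgn c · x) ε →
              ∃[ ε ] 0ℚ < ε × (∀ δ → 0ℚ ≤ δ → δ ≤ ε → LPFeasible (move x δ v))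
    combine (ε₁ , 0<ε₁ , bound₁) (ε₂ , 0<ε₂ , bound₂) (ε₃ , 0<ε₃ , bound₃) =
      ε₁ ℚ.⊓ ε₂ ℚ.⊓ ε₃ , 0<⊓ (0<⊓ 0<ε₁ 0<ε₂) 0<ε₃ , λ δ 0≤δ δ≤ε →
      let δ≤ε₁₂ = ℚ.≤-trans δ≤ε (ℚ.p⊓q≤p (ε₁ ℚ.⊓ ε₂) ε₃)
          δ≤ε₁  = ℚ.≤-trans δ≤ε₁₂ (ℚ.p⊓q≤p ε₁ ε₂)
          δ≤ε₂  = ℚ.≤-trans δ≤ε₁₂ (ℚ.p⊓q≤q ε₁ ε₂)
          δ≤ε₃  = ℚ.≤-trans δ≤ε (ℚ.p⊓q≤q (ε₁ ℚ.⊓ ε₂) ε₃)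
      in record
        { capacity = subst (_≤ ι (+ b)) (sym (capacity-unchanged δ)) (LPFeasible.capacity x-feas)
        ; color    = λ c → subst (_≤ 1ℚ) (sym (sumOver-∁ (items c) (move x δ v)))
            (≤-certificate (color-slack δ c) (0≤q-p (bound₃ c δ 0≤δ δ≤ε₃)))
        ; nonneg   = λ i → ≤-certificate
            (solve 3 (λ x δ v → x :+ δ :* v :- con 0ℚ := x :- δ :* (:- v)) refl (x i) δ (v i))
            (0≤q-p (bound₁ i δ 0≤δ δ≤ε₁))
        ; atMost1  = λ i → ≤-certificate
            (solve 3 (λ x δ v → con 1ℚ :- (x :+ δ :* v) := (con 1ℚ :- x) :- δ :* v) refl
              (x i) δ (v i))
            (0≤q-p (bound₂ i δ 0≤δ δ≤ε₂))
        }

  -- Otherwise `x` would be the midpoint of two distinct feasible points, one step along `v` and the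
  -- same step along its opposite.
  extreme-rigid : ∀ {x v} → LPExtreme x → Direction x v → ∀ i → v i ≡ 0ℚ
  extreme-rigid {x} {v} (x-feas , x-extreme) dir i =
    combine (move-feasible x-feas dir) (move-feasible x-feas (opposite dir))
    where
    v⁻ : Vector ℚ n
    v⁻ i = - 1ℚ * v i

    combine : ∃[ ε ] 0ℚ < ε × (∀ δ → 0ℚ ≤ δ → δ ≤ ε → LPFeasible (move x δ v)) →
              ∃[ ε ] 0ℚ < ε × (∀ δ → 0ℚ ≤ δ → δ ≤ ε → LPFeasible (move x δ v⁻)) →
              v i ≡ 0ℚ
    combine (ε₁ , 0<ε₁ , feas₁) (ε₂ , 0<ε₂ , feas₂) =
      *-zero-cancelˡ {ε} (λ ε≡0 → ℚ.<⇒≢ 0<ε (sym ε≡0))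
        -- `ε * v i` is half the difference of the two end points, which extremality makes equal.
        (trans (solve 3 (λ x e v → e :* v :=
                  con ½ :* ((x :+ e :* v) :- (x :+ e :* (con (- 1ℚ) :* v)))) refl (x i) ε (v i))
          (trans (cong (λ q → ½ * (q ⊖ move x ε v⁻ i)) y≡z)
                 (cong (½ *_) (ℚ.+-inverseʳ (move x ε v⁻ i)))))
      where
      ε : ℚ
      ε = ε₁ ℚ.⊓ ε₂
      0<ε : 0ℚ < ε
      0<ε = 0<⊓ 0<ε₁ 0<ε₂
      y≡z : move x ε v i ≡ move x ε v⁻ i
      y≡z = x-extreme (move x ε v) (move x ε v⁻) ½
        (feas₁ ε (ℚ.<⇒≤ 0<ε) (ℚ.p⊓q≤p ε₁ ε₂)) (feas₂ ε (ℚ.<⇒≤ 0<ε) (ℚ.p⊓q≤q ε₁ ε₂))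
        (ℚ.positive⁻¹ ½) (ℚ.*<* (ℤ.+<+ (ℕ.s≤s (ℕ.s≤s ℕ.z≤n))))
        (λ j → solve 3 (λ x e v → x := con ½ :* (x :+ e :* v)
                  :+ (con 1ℚ :- con ½) :* (x :+ e :* (con (- 1ℚ) :* v))) refl (x j) ε (v j))
        i

-- Predicates with at most two witnesses, and vectors supported on two indices

data AtMostTwo {n} (P : Fin n → Set) : Set where
  none : (∀ i → ¬ P i) → AtMostTwo P
  one  : ∀ i → P i → (∀ j → P j → j ≡ i) → AtMostTwo P
  two  : ∀ i j → i ≢ j → P i → P j → (∀ k → P k → k ≡ i ⊎ k ≡ j) → AtMostTwo P

atMostTwo : ∀ {n} {P : Fin n → Set} → Decidable P →
            (∀ i j k → i ≢ j → k ≢ i → k ≢ j → P i → P j → ¬ P k) → AtMostTwo P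
atMostTwo {P = P} P? noThree with Fin.any? P?
... | no ∄P = none (λ i Pi → ∄P (i , Pi))
... | yes (i , Pi) with Fin.any? (λ j → P? j ×-dec ¬? (j Fin.≟ i))
...   | no ∄j = one i Pi only
  where
  only : ∀ j → P j → j ≡ i
  only j Pj with j Fin.≟ i
  ... | yes j≡i = j≡i
  ... | no  j≢i = ⊥-elim (∄j (j , Pj , j≢i))
...   | yes (j , Pj , j≢i) = two i j (j≢i ∘ sym) Pi Pj only
  where
  only : ∀ k → P k → k ≡ i ⊎ k ≡ j
  only k Pk with k Fin.≟ i | k Fin.≟ j
  ... | yes k≡i | _       = inj₁ k≡i
  ... | no _    | yes k≡j = inj₂ k≡j
  ... | no k≢i  | no k≢j  = ⊥-elim (noThree i j k (j≢i ∘ sym) k≢i k≢j Pi Pj Pk)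

single-0 : ∀ {n} (i j : Fin n) → single i 0ℚ j ≡ 0ℚ
single-0 i j with j Fin.≟ i
... | yes _ = refl
... | no  _ = refl

-- The entries add up when `i` and `j` coincide; with `b` equal to 0 the same form then covers a
-- single fractional item.
pair : ∀ {n} → Fin n → ℚ → Fin n → ℚ → Vector ℚ n
pair i a j b l = single i a l + single j b l

·-pair : ∀ {n} (f : Vector ℚ n) i a j b → f · pair i a j b ≡ f i * a + f j * b
·-pair f i a j b =
  trans (·-+ f (single i a) (single j b)) (cong₂ _+_ (·-single f i a) (·-single f j b))

pair-fst : ∀ {n} {i j : Fin n} a b → i ≢ j → pair i a j b i ≡ a
pair-fst {i = i} a b i≢j =
  trans (cong₂ _+_ (single-≡ i a) (single-≢ b i≢j)) (ℚ.+-identityʳ a)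

pair-snd : ∀ {n} {i j : Fin n} a b → i ≢ j → pair i a j b j ≡ b
pair-snd {j = j} a b i≢j =
  trans (cong₂ _+_ (single-≢ a (i≢j ∘ sym)) (single-≡ j b)) (ℚ.+-identityˡ b)

pair-other : ∀ {n} {i j l : Fin n} a b → l ≢ i → l ≢ j → pair i a j b l ≡ 0ℚ
pair-other a b l≢i l≢j = cong₂ _+_ (single-≢ a l≢i) (single-≢ b l≢j)

-- Fractional items of an extreme point

module Structure (I : Instance) where
  open ColKP I
  open LP I

  wℚ-pos : ∀ i → 0ℚ < wℚ i
  wℚ-pos i = ι-mono-< (ℤ.+<+ (w>0 i))

  sgn-does : ∀ c i → sgn c i ≡ (if does (κ i Fin.≟ c) then 1ℚ else - 1ℚ)
  sgn-does c i = cong (λ t → if t then 1ℚ else - 1ℚ) (lookup∘tabulate (λ i → does (κ i Fin.≟ c)) i)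

  sgn-± : ∀ c i → sgn c i ≡ 1ℚ ⊎ sgn c i ≡ - 1ℚ
  sgn-± c i with lookup (items c) i
  ... | true  = inj₁ refl
  ... | false = inj₂ refl

  -- An item has only one colour, so at least one of the two signs is -1.
  sgn+sgn≤0 : ∀ {c c′} → c ≢ c′ → ∀ i → sgn c i + sgn c′ i ≤ 0ℚ
  sgn+sgn≤0 {c} {c′} c≢c′ i =
    subst (_≤ 0ℚ) (sym (cong₂ _+_ (sgn-does c i) (sgn-does c′ i))) by-cases
    where
    by-cases : (if does (κ i Fin.≟ c) then 1ℚ else - 1ℚ) +
               (if does (κ i Fin.≟ c′) then 1ℚ else - 1ℚ) ≤ 0ℚ
    by-cases with κ i Fin.≟ c | κ i Fin.≟ c′
    ... | yes κi≡c | yes κi≡c′ = ⊥-elim (c≢c′ (trans (sym κi≡c) κi≡c′))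
    ... | yes _    | no _      = ℚ.≤-refl
    ... | no _     | yes _     = ℚ.≤-refl
    ... | no _     | no _      = ℚ.*≤* ℤ.-≤+

  sgn·+sgn·≤0 : ∀ {c c′} → c ≢ c′ → ∀ x → (∀ i → 0ℚ ≤ x i) → sgn c · x + sgn c′ · x ≤ 0ℚ
  sgn·+sgn·≤0 {c} {c′} c≢c′ x 0≤x = subst (_≤ 0ℚ)
    (∑-distrib-+ (λ i → sgn c i * x i) (λ i → sgn c′ i * x i))
    (sum-nonPos (λ i → sgn c i * x i + sgn c′ i * x i) (λ i → ≤-certificate
      (solve 3 (λ s t x → con 0ℚ :- (s :* x :+ t :* x) := (con 0ℚ :- (s :+ t)) :* x) refl
        (sgn c i) (sgn c′ i) (x i))
      (0≤* (0≤q-p (sgn+sgn≤0 c≢c′ i)) (0≤x i))))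

  Tight : Vector ℚ n → Fin m → Set
  Tight x c = sgn c · x ≡ 1ℚ

  -- Two tight rows of different colours would add up to 2, while the sum of the two rows is
  -- nonpositive on nonnegative vectors.
  tight-unique : ∀ {x} → LPFeasible x → ∀ {c c′} → Tight x c → Tight x c′ → c ≡ c′
  tight-unique {x} x-feas {c} {c′} c-tight c′-tight with c Fin.≟ c′
  ... | yes c≡c′ = c≡c′
  ... | no  c≢c′ = ⊥-elim (ℚ.<-irrefl refl (ℚ.<-≤-trans (0<+ 0<1 (ℚ.<⇒≤ 0<1))
    (subst₂ (λ s t → s + t ≤ 0ℚ) c-tight c′-tight
      (sgn·+sgn·≤0 c≢c′ x (LPFeasible.nonneg x-feas)))))

  Fractional : Vector ℚ n → Fin n → Set
  Fractional x i = ¬ Integral (x i)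

  integral? : ∀ q → Dec (Integral q)
  integral? q = (q ℚ.≟ 0ℚ) ⊎-dec (q ℚ.≟ 1ℚ)

  -- The tight colour constraints at x, if any, all coincide with the row a.
  Controls : Vector ℚ n → Vector ℚ n → Set
  Controls a x = ∀ c → Tight x c → ∀ v → a · v ≡ 0ℚ → sgn c · v ≡ 0ℚ

  module _ {x : Vector ℚ n} (x-extreme : LPExtreme x) {a : Vector ℚ n} (a-controls : Controls a x) where

    rigid : ∀ v → (∀ i → Integral (x i) → v i ≡ 0ℚ) → wℚ · v ≡ 0ℚ → a · v ≡ 0ℚ → ∀ i → v i ≡ 0ℚ
    rigid v v-integral wv≡0 av≡0 = extreme-rigid x-extreme (record
      { integral = v-integral
      ; capacity = wv≡0
      ; color    = λ c c-tight → a-controls c c-tight v av≡0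
      })

    -- The vector with `wℚ j` at `i` and `- wℚ i` at `j` leaves the load unchanged. If the
    -- determinant vanished, `a` would not see it either; rigidity would then force `wℚ j` to be 0.
    independent : ∀ {i j} → i ≢ j → Fractional x i → Fractional x j →
                  a i * wℚ j ⊖ a j * wℚ i ≢ 0ℚ
    independent {i} {j} i≢j i-frac j-frac det≡0 =
      ℚ.<⇒≢ (wℚ-pos j) (sym (trans (sym (pair-fst (wℚ j) (- wℚ i) i≢j)) (rigid v v-integral wv≡0 av≡0 i)))
      where
      v : Vector ℚ n
      v = pair i (wℚ j) j (- wℚ i)
      v-integral : ∀ l → Integral (x l) → v l ≡ 0ℚ
      v-integral l l-int = pair-other (wℚ j) (- wℚ i)
        (λ l≡i → i-frac (subst (Integral ∘ x) l≡i l-int))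
        (λ l≡j → j-frac (subst (Integral ∘ x) l≡j l-int))
      wv≡0 : wℚ · v ≡ 0ℚ
      wv≡0 = trans (·-pair wℚ i (wℚ j) j (- wℚ i))
        (solve 2 (λ p q → p :* q :+ q :* (:- p) := con 0ℚ) refl (wℚ i) (wℚ j))
      av≡0 : a · v ≡ 0ℚ
      av≡0 = trans (·-pair a i (wℚ j) j (- wℚ i))
        (trans (solve 4 (λ r s p q → r :* q :+ s :* (:- p) := r :* q :- s :* p) refl
                 (a i) (a j) (wℚ i) (wℚ j)) det≡0)

    -- The cross product of the rows `a` and `wℚ`, restricted to the three items, is orthogonal to
    -- both rows. Rigidity makes it vanish, yet its entry at `k` is the determinant that
    -- `independent` shows to be nonzero.
    noThree : ∀ i j k → i ≢ j → k ≢ i → k ≢ j →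
              Fractional x i → Fractional x j → ¬ Fractional x k
    noThree i j k i≢j k≢i k≢j i-frac j-frac k-frac =
      independent i≢j i-frac j-frac (trans (sym vk≡det) (rigid v v-integral wv≡0 av≡0 k))
      where
      α β γ : ℚ
      α = a j * wℚ k ⊖ a k * wℚ j
      β = a k * wℚ i ⊖ a i * wℚ k
      γ = a i * wℚ j ⊖ a j * wℚ i
      v : Vector ℚ n
      v l = pair i α j β l + single k γ l
      ·v : ∀ f → f · v ≡ (f i * α + f j * β) + f k * γ
      ·v f = trans (·-+ f (pair i α j β) (single k γ)) (cong₂ _+_ (·-pair f i α j β) (·-single f k γ))
      vk≡det : v k ≡ γ
      vk≡det = trans (cong₂ _+_ (pair-other α β k≢i k≢j) (single-≡ k γ)) (ℚ.+-identityˡ γ)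
      v-integral : ∀ l → Integral (x l) → v l ≡ 0ℚ
      v-integral l l-int = cong₂ _+_
        (pair-other α β (λ l≡i → i-frac (subst (Integral ∘ x) l≡i l-int))
                        (λ l≡j → j-frac (subst (Integral ∘ x) l≡j l-int)))
        (single-≢ γ (λ l≡k → k-frac (subst (Integral ∘ x) l≡k l-int)))
      wv≡0 : wℚ · v ≡ 0ℚ
      wv≡0 = trans (·v wℚ)
        (solve 6 (λ s t u p q r →
            (p :* (t :* r :- u :* q) :+ q :* (u :* p :- s :* r)) :+ r :* (s :* q :- t :* p) := con 0ℚ)
          refl (a i) (a j) (a k) (wℚ i) (wℚ j) (wℚ k))
      av≡0 : a · v ≡ 0ℚ
      av≡0 = trans (·v a)
        (solve 6 (λ s t u p q r →
            (s :* (t :* r :- u :* q) :+ t :* (u :* p :- s :* r)) :+ u :* (s :* q :- t :* p) := con 0ℚ)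
          refl (a i) (a j) (a k) (wℚ i) (wℚ j) (wℚ k))

  χ-ones : ∀ {x i} → Integral (x i) → χ (ones x) i ≡ x i
  χ-ones {x} {i} x-int = trans
    (cong (λ t → if t then 1ℚ else 0ℚ) (lookup∘tabulate (λ i → does (x i ℚ.≟ 1ℚ)) i)) (by-cases x-int)
    where
    by-cases : Integral (x i) → (if does (x i ℚ.≟ 1ℚ) then 1ℚ else 0ℚ) ≡ x i
    by-cases x-int with x i ℚ.≟ 1ℚ | x-int
    ... | yes x≡1 | _        = sym x≡1
    ... | no  _   | inj₁ x≡0 = sym x≡0
    ... | no  x≢1 | inj₂ x≡1 = ⊥-elim (x≢1 x≡1)

  χ-ones-fractional : ∀ {x i} → Fractional x i → χ (ones x) i ≡ 0ℚ
  χ-ones-fractional {x} {i} x-frac = trans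
    (cong (λ t → if t then 1ℚ else 0ℚ) (lookup∘tabulate (λ i → does (x i ℚ.≟ 1ℚ)) i)) by-cases
    where
    by-cases : (if does (x i ℚ.≟ 1ℚ) then 1ℚ else 0ℚ) ≡ 0ℚ
    by-cases with x i ℚ.≟ 1ℚ
    ... | yes x≡1 = ⊥-elim (x-frac (inj₂ x≡1))
    ... | no  _   = refl

  -- The point `x` is the indicator of `ones x` plus `a` at `i` and `b` at `j`, expressed through
  -- all linear functionals. With fewer than two fractional items the missing coefficients are 0,
  -- and `i` and `j` may coincide. The field `binding` keeps the fact that a second fractional item
  -- requires a tight colour constraint.
  record FractionalPart (x : Vector ℚ n) : Set where
    field
      i j     : Fin n
      a b     : ℚ
      0≤a     : 0ℚ ≤ a
      a<1     : a < 1ℚ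
      0≤b     : 0ℚ ≤ b
      b<1     : b < 1ℚ
      split   : ∀ f → f · x ≡ f · χ (ones x) + (f i * a + f j * b)
      binding : b ≡ 0ℚ ⊎ ∃[ c ] Tight x c

  splitting : ∀ x i a j b → (∀ l → Integral (x l) → pair i a j b l ≡ 0ℚ) →
              (∀ l → Fractional x l → pair i a j b l ≡ x l) →
              ∀ f → f · x ≡ f · χ (ones x) + (f i * a + f j * b)
  splitting x i a j b v-integral v-fractional f =
    trans (·-congʳ f x≗χ+v)
      (trans (·-+ f (χ (ones x)) (pair i a j b)) (cong (λ q → f · χ (ones x) + q) (·-pair f i a j b)))
    where
    x≗χ+v : x ≗ (λ l → χ (ones x) l + pair i a j b l)
    x≗χ+v l with integral? (x l)
    ... | yes l-int  = sym (trans (cong₂ _+_ (χ-ones {x} l-int) (v-integral l l-int)) (ℚ.+-identityʳ (x l)))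
    ... | no  l-frac = sym (trans (cong₂ _+_ (χ-ones-fractional {x} l-frac) (v-fractional l l-frac))
                                  (ℚ.+-identityˡ (x l)))

  fractionalPart : ∀ {x} → LPExtreme x → Fin n → FractionalPart x
  fractionalPart {x} x-extreme@(x-feas , _) r = tightOrNot (Fin.any? (λ c → sgn c · x ℚ.≟ 1ℚ))
    where
    open LPFeasible x-feas using (nonneg; atMost1)

    frac<1 : ∀ {i} → Fractional x i → x i < 1ℚ
    frac<1 {i} i-frac = ≢∧≤⇒< (i-frac ∘ inj₂) (atMost1 i)

    part : (∀ i j → i ≢ j → Fractional x i → Fractional x j → ∃[ c ] Tight x c) →
           AtMostTwo (Fractional x) → FractionalPart x
    -- The item `r` only fills both places; its coefficients are 0.
    part _ (none ∄frac) = record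
      { i = r ; j = r ; a = 0ℚ ; b = 0ℚ
      ; 0≤a = ℚ.≤-refl ; a<1 = 0<1 ; 0≤b = ℚ.≤-refl ; b<1 = 0<1
      ; split = splitting x r 0ℚ r 0ℚ (λ l _ → cong₂ _+_ (single-0 r l) (single-0 r l))
                  (λ l l-frac → ⊥-elim (∄frac l l-frac))
      ; binding = inj₁ refl
      }
    part _ (one i i-frac only) = record
      { i = i ; j = i ; a = x i ; b = 0ℚ
      ; 0≤a = nonneg i ; a<1 = frac<1 i-frac ; 0≤b = ℚ.≤-refl ; b<1 = 0<1
      ; split = splitting x i (x i) i 0ℚ
          (λ l l-int → cong₂ _+_
            (single-≢ (x i) (λ l≡i → i-frac (subst (Integral ∘ x) l≡i l-int))) (single-0 i l))
          (λ l l-frac → subst (λ l → pair i (x i) i 0ℚ l ≡ x l) (sym (only l l-frac))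
            (trans (cong₂ _+_ (single-≡ i (x i)) (single-0 i i)) (ℚ.+-identityʳ (x i))))
      ; binding = inj₁ refl
      }
    part tight (two i j i≢j i-frac j-frac only) = record
      { i = i ; j = j ; a = x i ; b = x j
      ; 0≤a = nonneg i ; a<1 = frac<1 i-frac ; 0≤b = nonneg j ; b<1 = frac<1 j-frac
      ; split = splitting x i (x i) j (x j)
          (λ l l-int → pair-other (x i) (x j)
            (λ l≡i → i-frac (subst (Integral ∘ x) l≡i l-int))
            (λ l≡j → j-frac (subst (Integral ∘ x) l≡j l-int)))
          (λ l l-frac → agree l (only l l-frac))
      ; binding = inj₂ (tight i j i≢j i-frac j-frac)
      }
      where
      agree : ∀ l → l ≡ i ⊎ l ≡ j → pair i (x i) j (x j) l ≡ x l
      agree l (inj₁ refl) = pair-fst (x i) (x j) i≢j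
      agree l (inj₂ refl) = pair-snd (x i) (x j) i≢j

    tightOrNot : Dec (∃[ c ] Tight x c) → FractionalPart x
    tightOrNot (yes (c , c-tight)) = part (λ _ _ _ _ _ → c , c-tight)
      (atMostTwo (λ i → ¬? (integral? (x i))) (noThree x-extreme {sgn c} controls))
      where
      controls : Controls (sgn c) x
      controls c′ c′-tight v cv≡0 =
        subst (λ c → sgn c · v ≡ 0ℚ) (tight-unique x-feas c-tight c′-tight) cv≡0
    tightOrNot (no ∄tight) = part
      -- With no tight colour constraint the zero row controls `x`. Its determinant with the weights
      -- is always 0, so two fractional items are already impossible.
      (λ i j i≢j i-frac j-frac → ⊥-elim (independent x-extreme {zeros} controls i≢j i-frac j-frac
        (solve 2 (λ p q → con 0ℚ :* p :- con 0ℚ :* q := con 0ℚ) refl (wℚ j) (wℚ i))))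
      (atMostTwo (λ i → ¬? (integral? (x i))) (noThree x-extreme {zeros} controls))
      where
      zeros : Vector ℚ n
      zeros _ = 0ℚ
      controls : Controls zeros x
      controls c c-tight = ⊥-elim (∄tight (c , c-tight))

-- Lower bound: every run attains at least a third of the optimum

≤foldr-⊔ : ∀ {l} (f : Vector ℕ l) c → f c ℕ.≤ foldr ℕ._⊔_ 0 f
≤foldr-⊔ f zero    = ℕ.m≤m⊔n (f zero) _
≤foldr-⊔ f (suc c) = ℕ.≤-trans (≤foldr-⊔ (f ∘ suc) c) (ℕ.m≤n⊔m (f zero) _)

-- The comparison is made over unnormalised rationals, where it is cross multiplication by
-- definition.
≤-/ : ∀ q d .{{_ : ℕ.NonZero d}} → + d ℤ.≤ q ℤ.* + 3 → + 1 / 3 ≤ q / d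
≤-/ q (suc d-1) d≤3q = ℚ.toℚᵘ-cancel-≤
  (ℚᵘ.≤-respʳ-≃ (ℚᵘ.≃-sym (ℚ.toℚᵘ-fromℚᵘ (ℚᵘ.mkℚᵘ q d-1)))
    (ℚᵘ.*≤* (subst (ℤ._≤ q ℤ.* + 3) (sym (ℤ.*-identityˡ (+ suc d-1))) d≤3q)))

Sign : ℚ → Set
Sign s = s ≡ 1ℚ ⊎ s ≡ - 1ℚ

module _ {a b s t : ℚ} (0≤a : 0ℚ ≤ a) (a<1 : a < 1ℚ) (0≤b : 0ℚ ≤ b) (b<1 : b < 1ℚ) where

  -- Two fractional items raise the left side of a colour constraint by less than 2, too little to
  -- make up for a deficit of 2 at the rounded set.
  signed-sum<2 : Sign s → Sign t → s * a + t * b < 1ℚ + 1ℚ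
  signed-sum<2 (inj₁ refl) (inj₁ refl) = <-certificate
    (solve 2 (λ a b → con 1ℚ :+ con 1ℚ :- (con 1ℚ :* a :+ con 1ℚ :* b) :=
                      (con 1ℚ :- a) :+ (con 1ℚ :- b)) refl a b)
    (0<+ (0<q-p a<1) (0≤q-p (ℚ.<⇒≤ b<1)))
  signed-sum<2 (inj₁ refl) (inj₂ refl) = <-certificate
    (solve 2 (λ a b → con 1ℚ :+ con 1ℚ :- (con 1ℚ :* a :+ con (- 1ℚ) :* b) :=
                      (con 1ℚ :- a) :+ (con 1ℚ :+ b)) refl a b)
    (0<+ (0<q-p a<1) (0≤+ (ℚ.<⇒≤ 0<1) 0≤b))
  signed-sum<2 (inj₂ refl) (inj₁ refl) = <-certificate
    (solve 2 (λ a b → con 1ℚ :+ con 1ℚ :- (con (- 1ℚ) :* a :+ con 1ℚ :* b) :=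
                      (con 1ℚ :- b) :+ (con 1ℚ :+ a)) refl a b)
    (0<+ (0<q-p b<1) (0≤+ (ℚ.<⇒≤ 0<1) 0≤a))
  signed-sum<2 (inj₂ refl) (inj₂ refl) = <-certificate
    (solve 2 (λ a b → con 1ℚ :+ con 1ℚ :- (con (- 1ℚ) :* a :+ con (- 1ℚ) :* b) :=
                      con 1ℚ :+ (con 1ℚ :+ (a :+ b))) refl a b)
    (0<+ 0<1 (0≤+ (ℚ.<⇒≤ 0<1) (0≤+ 0≤a 0≤b)))

  -- One positive sign would leave the sum above -1, since the other term is greater than -1.
  both-negative : Sign s → Sign t → s * a + t * b ≤ - 1ℚ → s ≡ - 1ℚ × t ≡ - 1ℚ
  both-negative (inj₂ s≡-1) (inj₂ t≡-1) _ = s≡-1 , t≡-1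
  both-negative (inj₁ refl) (inj₁ refl) sum≤-1 = contradiction
    (ℚ.≤-<-trans sum≤-1 (<-certificate
      (solve 2 (λ a b → (con 1ℚ :* a :+ con 1ℚ :* b) :- con (- 1ℚ) := con 1ℚ :+ (a :+ b)) refl a b)
      (0<+ 0<1 (0≤+ 0≤a 0≤b))))
    (ℚ.<-irrefl refl)
  both-negative (inj₁ refl) (inj₂ refl) sum≤-1 = contradiction
    (ℚ.≤-<-trans sum≤-1 (<-certificate
      (solve 2 (λ a b → (con 1ℚ :* a :+ con (- 1ℚ) :* b) :- con (- 1ℚ) := (con 1ℚ :- b) :+ a)
        refl a b)
      (0<+ (0<q-p b<1) 0≤a)))
    (ℚ.<-irrefl refl)
  both-negative (inj₂ refl) (inj₁ refl) sum≤-1 = contradiction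
    (ℚ.≤-<-trans sum≤-1 (<-certificate
      (solve 2 (λ a b → (con (- 1ℚ) :* a :+ con 1ℚ :* b) :- con (- 1ℚ) := (con 1ℚ :- a) :+ b)
        refl a b)
      (0<+ (0<q-p a<1) 0≤b)))
    (ℚ.<-irrefl refl)

module LowerBound (I : Instance) where
  open ColKP I hiding (b)
  open LP I
  open Structure I

  lpValue-χ : ∀ S → lpValue (χ S) ≡ ι (profit S)
  lpValue-χ S = trans (·χ pℚ S) (sym (ι-sumOverℤ S p))

  -- This makes the LP a relaxation of the problem, whence its value bounds `OPT`.
  χ-feasible : ∀ {S} → Feasible S → LPFeasible (χ S)
  χ-feasible {S} (S-color , S-weight) = record
    { capacity = subst (_≤ ι (+ Instance.b I)) (sym (trans (·χ wℚ S) (sym (ι-sumOverℕ S w))))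
                   (ι-mono-≤ (ℤ.+≤+ S-weight))
    ; color    = λ c → subst (_≤ 1ℚ)
                   (sym (trans (sumOver-∁ (items c) (χ S)) (σ·χ (items c) S))) (color-bound c)
    ; nonneg   = nonneg
    ; atMost1  = atMost1
    }
    where
    2k≤∣S∣+1 : ∀ c → k S c ℕ.+ k S c ℕ.≤ ∣ S ∣ ℕ.+ 1
    2k≤∣S∣+1 c = ℕ.≤-trans
      (ℕ.+-mono-≤ (≤foldr-⊔ (k S) c)
        (ℕ.≤-trans (≤foldr-⊔ (k S) c) (ℕ.≤-reflexive (sym (ℕ.+-identityʳ (d S))))))
      S-color
    color-bound : ∀ c → ι (+ k S c) + ι (+ k S c) ⊖ ι (+ ∣ S ∣) ≤ 1ℚ
    color-bound c = ≤-certificate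
      (solve 2 (λ k s → con 1ℚ :- (k :+ k :- s) := (s :+ con 1ℚ) :- (k :+ k)) refl
        (ι (+ k S c)) (ι (+ ∣ S ∣)))
      (0≤q-p (subst₂ _≤_ (ι-+ (+ k S c) (+ k S c)) (ι-+ (+ ∣ S ∣) (+ 1))
               (ι-mono-≤ (ℤ.+≤+ (2k≤∣S∣+1 c)))))
    nonneg : ∀ i → 0ℚ ≤ χ S i
    nonneg i with lookup S i
    ... | true  = ℚ.<⇒≤ 0<1
    ... | false = ℚ.≤-refl
    atMost1 : ∀ i → χ S i ≤ 1ℚ
    atMost1 i with lookup S i
    ... | true  = ℚ.≤-refl
    ... | false = ℚ.<⇒≤ 0<1

  OPT≤lpValue : ∀ {x} → LPOptimal x → ι OPT ≤ lpValue x
  OPT≤lpValue {x} (_ , x-optimal) = subst (_≤ lpValue x) (lpValue-χ optimalSet)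
    (x-optimal (χ optimalSet) (χ-feasible {optimalSet} OPT-attained))

  module _ {x : Vector ℚ n} (x-extreme : LPExtreme x) (part : FractionalPart x) where
    open FractionalPart part

    private
      T : Subset n
      T = ones x

    module Removal {c : Fin m} (T-infeasible : ¬ ColorFeasible T) (c-dominant : Dominant T c) where

      ∣T∣+2≤2k : ∣ T ∣ ℕ.+ 2 ℕ.≤ k T c ℕ.+ k T c
      ∣T∣+2≤2k = subst₂ ℕ._≤_ (sym (ℕ.+-suc ∣ T ∣ 1))
        (trans (cong (2 ℕ.*_) (sym c-dominant)) (cong (k T c ℕ.+_) (ℕ.+-identityʳ (k T c))))
        -- Infeasibility says `2 d > |T| + 1`, hence `2 d ≥ |T| + 2`, and `d` is attained at the
        -- dominant colour.
        (ℕ.≰⇒> T-infeasible)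

      excess : ℚ
      excess = sgn c · χ T

      excess≡ : excess ≡ ι (+ (k T c ℕ.+ k T c)) ⊖ ι (+ ∣ T ∣)
      excess≡ = trans (σ·χ (items c) T) (cong (_⊖ ι (+ ∣ T ∣)) (sym (ι-+ (+ k T c) (+ k T c))))

      2≤excess : 1ℚ + 1ℚ ≤ excess
      2≤excess = subst (1ℚ + 1ℚ ≤_) (sym excess≡) (≤-certificate
        (solve 2 (λ k s → k :- s :- (con 1ℚ :+ con 1ℚ) := k :- (s :+ (con 1ℚ :+ con 1ℚ))) refl
          (ι (+ (k T c ℕ.+ k T c))) (ι (+ ∣ T ∣)))
        (0≤q-p (subst (_≤ ι (+ (k T c ℕ.+ k T c))) (ι-+ (+ ∣ T ∣) (+ 2))
          (ι-mono-≤ (ℤ.+≤+ ∣T∣+2≤2k)))))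

      -- Integrality: the excess is a difference of two natural numbers, so the strict bound is
      -- pulled back to the naturals and loses one there.
      excess<3⇒excess≤2 : excess < 1ℚ + (1ℚ + 1ℚ) → excess ≤ 1ℚ + 1ℚ
      excess<3⇒excess≤2 excess<3 = subst (_≤ 1ℚ + 1ℚ) (sym excess≡) (≤-certificate
        (solve 2 (λ k s → con 1ℚ :+ con 1ℚ :- (k :- s) := (s :+ (con 1ℚ :+ con 1ℚ)) :- k) refl
          (ι (+ (k T c ℕ.+ k T c))) (ι (+ ∣ T ∣)))
        (0≤q-p (subst (ι (+ (k T c ℕ.+ k T c)) ≤_) (ι-+ (+ ∣ T ∣) (+ 2))
          (ι-mono-≤ (ℤ.+≤+ 2k≤∣T∣+2)))))
        where
        2k<∣T∣+3 : ι (+ (k T c ℕ.+ k T c)) < ι (+ (∣ T ∣ ℕ.+ 3))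
        2k<∣T∣+3 = <-certificate
          (trans (cong (_⊖ ι (+ (k T c ℕ.+ k T c))) (ι-+ (+ ∣ T ∣) (+ 3)))
            (solve 2 (λ k s → s :+ con (ι (+ 3)) :- k :=
                              (con 1ℚ :+ (con 1ℚ :+ con 1ℚ)) :- (k :- s)) refl
              (ι (+ (k T c ℕ.+ k T c))) (ι (+ ∣ T ∣))))
          (0<q-p (subst (_< 1ℚ + (1ℚ + 1ℚ)) excess≡ excess<3))
        2k≤∣T∣+2 : k T c ℕ.+ k T c ℕ.≤ ∣ T ∣ ℕ.+ 2
        2k≤∣T∣+2 = ℕ.s≤s⁻¹ (subst (k T c ℕ.+ k T c ℕ.<_) (ℕ.+-suc ∣ T ∣ 2)
                     (ℤ.drop‿+<+ (ι-cancel-< 2k<∣T∣+3)))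

      -- What the two fractional items add to a colour row.
      signed : Fin m → ℚ
      signed c′ = sgn c′ i * a + sgn c′ j * b

      -- Only c itself can be tight, and then the two fractional items have
      -- other colours and a + b = excess - 1 < 2; excess being an integer, a + b = 1.
      a+b≤1 : a + b ≤ 1ℚ
      a+b≤1 = from-binding binding
        where
        c-tight⇒a+b≤1 : Tight x c → a + b ≤ 1ℚ
        c-tight⇒a+b≤1 c-tight = from-signs
          (both-negative 0≤a a<1 0≤b b<1 (sgn-± c i) (sgn-± c j) (≤-certificate
            (trans (cong (λ q → - 1ℚ ⊖ q) signed≡)
              (solve 1 (λ e → con (- 1ℚ) :- (con 1ℚ :- e) := e :- (con 1ℚ :+ con 1ℚ)) refl excess))
            (0≤q-p 2≤excess)))
          where
          signed≡ : signed c ≡ 1ℚ ⊖ excess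
          signed≡ = trans (solve 2 (λ e s → s := (e :+ s) :- e) refl excess (signed c))
                          (cong (_⊖ excess) (trans (sym (split (sgn c))) c-tight))
          from-signs : sgn c i ≡ - 1ℚ × sgn c j ≡ - 1ℚ → a + b ≤ 1ℚ
          from-signs (si≡-1 , sj≡-1) = ≤-certificate
            (trans (cong (λ q → 1ℚ ⊖ q) a+b≡)
              (solve 1 (λ e → con 1ℚ :- (e :- con 1ℚ) := (con 1ℚ :+ con 1ℚ) :- e) refl excess))
            (0≤q-p (excess<3⇒excess≤2 (<-certificate
              (trans (solve 1 (λ e → con 1ℚ :+ (con 1ℚ :+ con 1ℚ) :- e :=
                                     (con 1ℚ :+ con 1ℚ) :- (e :- con 1ℚ)) refl excess)
                (trans (cong (λ q → 1ℚ + 1ℚ ⊖ q) (sym a+b≡))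
                  (solve 2 (λ a b → con 1ℚ :+ con 1ℚ :- (a :+ b) :=
                                    (con 1ℚ :- a) :+ (con 1ℚ :- b)) refl a b)))
              (0<+ (0<q-p a<1) (0≤q-p (ℚ.<⇒≤ b<1))))))
            where
            a+b≡ : a + b ≡ excess ⊖ 1ℚ
            a+b≡ = trans (solve 2 (λ a b → a :+ b :=
                             :- (con (- 1ℚ) :* a :+ con (- 1ℚ) :* b)) refl a b)
              (trans (cong -_ (trans (cong₂ (λ s t → s * a + t * b) (sym si≡-1) (sym sj≡-1)) signed≡))
                     (solve 1 (λ e → :- (con 1ℚ :- e) := e :- con 1ℚ) refl excess))

        -- At the indicator of `T` the rows of `c` and `c′` have sum at most 0, so the row of `c′`
        -- is at most -2 there. The fractional items add less than 2, which keeps the row negative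
        -- at `x`.
        other-not-tight : ∀ {c′} → c ≢ c′ → ¬ Tight x c′
        other-not-tight {c′} c≢c′ c′-tight = ℚ.<-irrefl refl (ℚ.≤-<-trans
          (ℚ.≤-trans (ℚ.<⇒≤ 0<1) (ℚ.≤-reflexive (trans (sym c′-tight) (split (sgn c′)))))
          (<-certificate
            (solve 3 (λ e f s → con 0ℚ :- (f :+ s) := ((con 1ℚ :+ con 1ℚ) :- s) :+
                ((con 0ℚ :- (e :+ f)) :+ (e :- (con 1ℚ :+ con 1ℚ)))) refl
              excess (sgn c′ · χ T) (signed c′))
            (0<+ (0<q-p (signed-sum<2 0≤a a<1 0≤b b<1 (sgn-± c′ i) (sgn-± c′ j)))
              (0≤+ (0≤q-p (sgn·+sgn·≤0 c≢c′ (χ T) 0≤χ)) (0≤q-p 2≤excess)))))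
          where
          0≤χ : ∀ i → 0ℚ ≤ χ T i
          0≤χ i with lookup T i
          ... | true  = ℚ.<⇒≤ 0<1
          ... | false = ℚ.≤-refl

        from-binding : b ≡ 0ℚ ⊎ ∃[ c ] Tight x c → a + b ≤ 1ℚ
        from-binding (inj₁ b≡0) = subst (_≤ 1ℚ)
          (sym (trans (cong (λ q → a + q) b≡0) (ℚ.+-identityʳ a))) (ℚ.<⇒≤ a<1)
        from-binding (inj₂ (c′ , c′-tight)) with c Fin.≟ c′
        ... | yes refl = c-tight⇒a+b≤1 c′-tight
        ... | no  c≢c′ = contradiction c′-tight (other-not-tight c≢c′)

    module _ {M : ℚ} (0<M : 0ℚ < M) (p≤M : ∀ i → pℚ i ≤ M) where

      -- Without removal each fractional item is worth at most `M`. With removal the removed item is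
      -- worth at most `M`, and both fractional items together at most `M (a + b) ≤ M`.
      repair-loss : ∀ {S₀} → Repair T S₀ → lpValue x ≤ ι (profit S₀) + (M + M)
      repair-loss (keep _) = subst (_≤ ι (profit T) + (M + M))
        (sym (trans (split pℚ) (cong (_+ (pℚ i * a + pℚ j * b)) (lpValue-χ T))))
        (≤-certificate
          (solve 6 (λ s M p a q b → (s :+ (M :+ M)) :- (s :+ (p :* a :+ q :* b)) :=
              ((M :- p) :* a :+ M :* (con 1ℚ :- a)) :+ ((M :- q) :* b :+ M :* (con 1ℚ :- b))) refl
            (ι (profit T)) M (pℚ i) a (pℚ j) b)
          (0≤+ (0≤+ (0≤* (0≤q-p (p≤M i)) 0≤a) (0≤* (ℚ.<⇒≤ 0<M) (0≤q-p (ℚ.<⇒≤ a<1))))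
               (0≤+ (0≤* (0≤q-p (p≤M j)) 0≤b) (0≤* (ℚ.<⇒≤ 0<M) (0≤q-p (ℚ.<⇒≤ b<1))))))
      repair-loss (remove c l T-infeasible c-dominant l∈T∩c _) =
        subst (_≤ ι (profit (T - l)) + (M + M))
          (sym (trans (split pℚ) (cong (_+ (pℚ i * a + pℚ j * b)) (trans (lpValue-χ T)
            (trans (cong ι (sumOverℤ-remove p (Subset.p∩q⊆p T (items c) l∈T∩c)))
                   (ι-+ (p l) (profit (T - l))))))))
          (≤-certificate
            (solve 7 (λ s M o p a q b → (s :+ (M :+ M)) :- ((o :+ s) :+ (p :* a :+ q :* b)) :=
                (M :- o) :+ (((M :- p) :* a :+ (M :- q) :* b) :+ M :* (con 1ℚ :- (a :+ b)))) refl
              (ι (profit (T - l))) M (pℚ l) (pℚ i) a (pℚ j) b)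
            (0≤+ (0≤q-p (p≤M l))
              (0≤+ (0≤+ (0≤* (0≤q-p (p≤M i)) 0≤a) (0≤* (0≤q-p (p≤M j)) 0≤b))
                   (0≤* (ℚ.<⇒≤ 0<M) (0≤q-p (Removal.a+b≤1 T-infeasible c-dominant))))))

  moreProfitable-≥ : ∀ {S T Ŝ} → MoreProfitableOf S T Ŝ →
                     profit S ℤ.≤ profit Ŝ × profit T ℤ.≤ profit Ŝ
  moreProfitable-≥ (inj₁ (refl , T≤S)) = ℤ.≤-refl , T≤S
  moreProfitable-≥ (inj₂ (refl , S≤T)) = S≤T , ℤ.≤-refl

  -- `OPT` is at most the LP value, hence at most `profit S₀ + 2 pmax`, and the returned set is at
  -- least as profitable as both `S₀` and the item `r`.
  OPT≤3profit : Admissible → ∀ {Ŝ} → LPRound Ŝ → OPT ℤ.≤ profit Ŝ ℤ.* + 3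
  OPT≤3profit adm {Ŝ} run = ι-cancel-≤ (subst (ι OPT ≤_) (sym (ι-* (profit Ŝ) (+ 3)))
    (ℚ.≤-trans (OPT≤lpValue optimal)
      (ℚ.≤-trans (repair-loss basic (fractionalPart basic r) 0<M p≤M rounded)
        (≤-certificate
          (solve 3 (λ z s M → z :* con (ι (+ 3)) :- (s :+ (M :+ M)) :=
                              (z :- s) :+ ((z :- M) :+ (z :- M))) refl
            (ι (profit Ŝ)) (ι (profit S₀)) (ι pmax))
          (0≤+ (0≤q-p (ι-mono-≤ S₀≤Ŝ)) (0≤+ (0≤q-p (ι-mono-≤ M≤Ŝ)) (0≤q-p (ι-mono-≤ M≤Ŝ))))))))
    where
    open LPRound run
    open Admissible adm
    0<M : 0ℚ < ι pmax
    0<M = ι-mono-< pmax>0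
    p≤M : ∀ i → pℚ i ≤ ι pmax
    p≤M i = ι-mono-≤ (p≤pmax i)
    pmax≤r : pmax ℤ.≤ profit ⁅ r ⁆
    pmax≤r with attained
    ... | i , pi≡pmax = subst₂ ℤ._≤_ pi≡pmax (sym (sumOverℤ-⁅⁆ r p)) (r-max i)
    S₀≤Ŝ : profit S₀ ℤ.≤ profit Ŝ
    S₀≤Ŝ = proj₁ (moreProfitable-≥ returned)
    M≤Ŝ : pmax ℤ.≤ profit Ŝ
    M≤Ŝ = ℤ.≤-trans pmax≤r (proj₂ (moreProfitable-≥ returned))

  ⅓≤ratio : ∀ adm {Ŝ} → LPRound Ŝ → + 1 / 3 ≤ ratio adm Ŝ
  ⅓≤ratio adm {Ŝ} run = ≤-/ (profit Ŝ) ℤ.∣ OPT ∣ {{_}}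
    (subst (ℤ._≤ profit Ŝ ℤ.* + 3) (sym (ℤ.0≤i⇒+∣i∣≡i (ℤ.<⇒≤ (OPT>0 adm)))) (OPT≤3profit adm run))

-- Upper bound: a family of instances with ratios approaching a third

/-*-ι : ∀ q d .{{_ : ℕ.NonZero d}} → q / d * ι (+ d) ≡ ι q
/-*-ι q (suc d-1) = ℚ.toℚᵘ-injective (begin
  ℚ.toℚᵘ (q / suc d-1 * ι (+ suc d-1))                ≈⟨ ℚ.toℚᵘ-homo-* (q / suc d-1) (ι (+ suc d-1)) ⟩
  ℚ.toℚᵘ (q / suc d-1) ℚᵘ.* ℚ.toℚᵘ (ι (+ suc d-1))    ≈⟨ ℚᵘ.*-cong (ℚ.toℚᵘ-fromℚᵘ (ℚᵘ.mkℚᵘ q d-1))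
                                                           (ℚ.toℚᵘ-fromℚᵘ (ℚᵘ.mkℚᵘ (+ suc d-1) 0)) ⟩
  ℚᵘ.mkℚᵘ q d-1 ℚᵘ.* ℚᵘ.mkℚᵘ (+ suc d-1) 0            ≈⟨ ℚᵘ.*≡* (trans (ℤ.*-identityʳ _)
                                                           (cong (λ e → q ℤ.* + e) (sym (ℕ.*-identityʳ (suc d-1))))) ⟩
  ℚᵘ.mkℚᵘ q 0                                         ≈⟨ ℚᵘ.≃-sym (ℚ.toℚᵘ-fromℚᵘ (ℚᵘ.mkℚᵘ q 0)) ⟩
  ℚ.toℚᵘ (ι q)                                        ∎)
  where open ℚᵘ.≃-Reasoning

-- The product is the numerator of `ε`, a positive integer. Thus the denominator of `ε` serves as an
-- Archimedean bound.
1≤ε*↧ε : ∀ ε → 0ℚ < ε → 1ℚ ≤ ε * ι (+ ℚ.↧ₙ ε)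
1≤ε*↧ε ε 0<ε = subst (1ℚ ≤_)
  (trans (sym (/-*-ι (ℚ.↥ ε) (ℚ.↧ₙ ε))) (cong (_* ι (+ ℚ.↧ₙ ε)) (ℚ.↥p/↧p≡p ε)))
  (ι-mono-≤ (ℤ.i<j⇒suc[i]≤j (subst₂ ℤ._<_ (ℤ.*-zeroˡ (ℚ.↧ ε)) (ℤ.*-identityʳ (ℚ.↥ ε)) (ℚ.drop-*<* 0<ε))))

+≡0 : ∀ {u v} → 0ℚ ≤ u → 0ℚ ≤ v → u + v ≡ 0ℚ → u ≡ 0ℚ × v ≡ 0ℚ
+≡0 {u} {v} 0≤u 0≤v u+v≡0 =
  ℚ.≤-antisym (ℚ.≤-trans (subst (_≤ u + v) (ℚ.+-identityʳ u) (ℚ.+-monoʳ-≤ u 0≤v)) (ℚ.≤-reflexive u+v≡0)) 0≤u ,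
  ℚ.≤-antisym (ℚ.≤-trans (subst (_≤ u + v) (ℚ.+-identityˡ v) (ℚ.+-monoˡ-≤ v 0≤u)) (ℚ.≤-reflexive u+v≡0)) 0≤v

module Family (N : ℕ) (2≤N : 2 ℕ.≤ N) where

  J : Instance
  J = record
    { n = 4 ; m = 2 ; b = N ℕ.+ N ℕ.+ 3
    ; w = lookup (1 ∷ 1 ∷ N ℕ.+ N ℕ.+ 2 ∷ N ℕ.+ N ∷ [])
    ; p = lookup (+ N ∷ + N ∷ + N ∷ + N ℤ.+ ℤ.- (+ 1) ∷ [])
    ; κ = lookup (0F ∷ 0F ∷ 1F ∷ 1F ∷ [])
    ; b>0 = ℕ.≤-trans (ℕ.s≤s ℕ.z≤n) (ℕ.m≤n+m 3 (N ℕ.+ N))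
    ; w>0 = λ where
        0F → ℕ.s≤s ℕ.z≤n
        1F → ℕ.s≤s ℕ.z≤n
        2F → ℕ.≤-trans (ℕ.s≤s ℕ.z≤n) (ℕ.m≤n+m 2 (N ℕ.+ N))
        3F → ℕ.≤-trans (ℕ.≤-trans (ℕ.s≤s ℕ.z≤n) 2≤N) (ℕ.m≤m+n N N)
    }

  open ColKP J
  open LP J using (wℚ; pℚ)

  p≤N : ∀ i → p i ℤ.≤ + N
  p≤N 0F = ℤ.≤-refl
  p≤N 1F = ℤ.≤-refl
  p≤N 2F = ℤ.≤-refl
  p≤N 3F = ℤ.i-j≤i (+ N) (+ 1)

  0<N : ℤ.0ℤ ℤ.< + N
  0<N = ℤ.+<+ (ℕ.≤-trans (ℕ.s≤s ℕ.z≤n) 2≤N)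

  admissible : Admissible
  admissible = record
    { pmax = + N
    ; attained = 0F , refl
    ; p≤pmax = p≤N
    ; pmax>0 = 0<N
    ; -pmax<p = λ where
        0F → -N<N
        1F → -N<N
        2F → -N<N
        3F → ℤ.<-≤-trans (ℤ.neg-mono-< 0<N) (ℤ.+-monoˡ-≤ (ℤ.- (+ 1)) (ℤ.+≤+ (ℕ.≤-trans (ℕ.s≤s ℕ.z≤n) 2≤N)))
    ; w≤b = λ where
        0F → ℕ.≤-trans (ℕ.s≤s ℕ.z≤n) (ℕ.m≤n+m 3 (N ℕ.+ N))
        1F → ℕ.≤-trans (ℕ.s≤s ℕ.z≤n) (ℕ.m≤n+m 3 (N ℕ.+ N))
        2F → ℕ.+-monoʳ-≤ (N ℕ.+ N) (ℕ.n≤1+n 2)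
        3F → ℕ.m≤m+n (N ℕ.+ N) 3
    }
    where
    -N<N : ℤ.- (+ N) ℤ.< + N
    -N<N = ℤ.<-trans (ℤ.neg-mono-< 0<N) 0<N

  P P-3/2 2ℚ 3ℚ : ℚ
  P = ι (+ N)
  P-3/2 = P ⊖ + 3 / 2
  2ℚ = ι (+ 2)
  3ℚ = ι (+ 3)

  -- This is where `2 ≤ N` enters: the multiplier on the upper bounds is strictly positive, so these
  -- bounds must be tight at every optimum.
  0<P-3/2 : 0ℚ < P-3/2
  0<P-3/2 = 0<q-p (ℚ.<-≤-trans (from-yes (+ 3 / 2 ℚ.<? ι (+ 2))) (ι-mono-≤ (ℤ.+≤+ 2≤N)))

  -- Together with `load≡` and `b≡` this presents the data as polynomials in `P`, the form that the
  -- ring solver needs.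
  lpValue≡ : ∀ x → lpValue x ≡ P * x 0F + (P * x 1F + (P * x 2F + ((P ⊖ 1ℚ) * x 3F + 0ℚ)))
  lpValue≡ x = cong (λ q → P * x 0F + (P * x 1F + (P * x 2F + (q * x 3F + 0ℚ)))) (ι-+ (+ N) (ℤ.- (+ 1)))

  load≡ : ∀ x → wℚ · x ≡ 1ℚ * x 0F + (1ℚ * x 1F + ((P + P + 2ℚ) * x 2F + ((P + P) * x 3F + 0ℚ)))
  load≡ x = cong₂ (λ q r → 1ℚ * x 0F + (1ℚ * x 1F + (q * x 2F + (r * x 3F + 0ℚ))))
    (trans (ι-+ (+ (N ℕ.+ N)) (+ 2)) (cong (_+ 2ℚ) (ι-+ (+ N) (+ N)))) (ι-+ (+ N) (+ N))

  b≡ : ι (+ b) ≡ P + P + 3ℚ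
  b≡ = trans (ι-+ (+ (N ℕ.+ N)) (+ 3)) (cong (_+ 3ℚ) (ι-+ (+ N) (+ N)))

  optimum : ℚ
  optimum = P + P + P ⊖ ½

  -- The zero terms are those left by unfolding the finite sums; with them the colour hypothesis
  -- applies to `colorSlack` by computation alone.
  capacitySlack colorSlack : (Fin 4 → ℚ) → ℚ
  capacitySlack x = (P + P + 3ℚ) ⊖ (1ℚ * x 0F + (1ℚ * x 1F + ((P + P + 2ℚ) * x 2F + ((P + P) * x 3F + 0ℚ))))
  colorSlack x = 1ℚ ⊖ ((x 0F + (x 1F + (0ℚ + (0ℚ + 0ℚ)))) ⊖ (0ℚ + (0ℚ + (x 2F + (x 3F + 0ℚ)))))

  -- The optimal dual solution: multiplier ½ on the capacity, 1 on colour 0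
  -- and P - 3/2 on the upper bounds of items 0 and 1.
  duality : ∀ x → optimum ⊖ lpValue x ≡
            (½ * capacitySlack x + colorSlack x) + (P-3/2 * (1ℚ ⊖ x 0F) + P-3/2 * (1ℚ ⊖ x 1F))
  duality x = trans (cong (λ q → optimum ⊖ q) (lpValue≡ x))
    (solve 5 (λ P x₀ x₁ x₂ x₃ →
      (P :+ P :+ P :- con ½) :- (P :* x₀ :+ (P :* x₁ :+ (P :* x₂ :+ ((P :- con 1ℚ) :* x₃ :+ con 0ℚ)))) :=
      (con ½ :* ((P :+ P :+ con 3ℚ) :- (con 1ℚ :* x₀ :+ (con 1ℚ :* x₁ :+
          ((P :+ P :+ con 2ℚ) :* x₂ :+ ((P :+ P) :* x₃ :+ con 0ℚ))))) :+
        (con 1ℚ :- ((x₀ :+ (x₁ :+ (con 0ℚ :+ (con 0ℚ :+ con 0ℚ)))) :-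
                    (con 0ℚ :+ (con 0ℚ :+ (x₂ :+ (x₃ :+ con 0ℚ))))))) :+
      ((P :- con (+ 3 / 2)) :* (con 1ℚ :- x₀) :+ (P :- con (+ 3 / 2)) :* (con 1ℚ :- x₁)))
      refl P (x 0F) (x 1F) (x 2F) (x 3F))

  module _ {x : Vector ℚ 4} (x-feas : LPFeasible x) where
    open LPFeasible x-feas using (atMost1)

    0≤capacity : 0ℚ ≤ ½ * capacitySlack x
    0≤capacity = 0≤* (ℚ.nonNegative⁻¹ ½) (0≤q-p (subst₂ _≤_ (load≡ x) b≡ (LPFeasible.capacity x-feas)))

    0≤color : 0ℚ ≤ colorSlack x
    0≤color = 0≤q-p (LPFeasible.color x-feas 0F)

    0≤bound : ∀ i → 0ℚ ≤ P-3/2 * (1ℚ ⊖ x i)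
    0≤bound i = 0≤* (ℚ.<⇒≤ 0<P-3/2) (0≤q-p (atMost1 i))

    lpValue≤optimum : lpValue x ≤ optimum
    lpValue≤optimum = ≤-certificate (duality x)
      (0≤+ (0≤+ 0≤capacity 0≤color) (0≤+ (0≤bound 0F) (0≤bound 1F)))

  x̂ : Fin 4 → ℚ
  x̂ = lookup (1ℚ ∷ 1ℚ ∷ ½ ∷ ½ ∷ [])

  -- Complementary slackness: the four nonnegative terms of `duality` sum to 0, so all vanish. This
  -- gives four linear equations, whose only solution is `x̂`.
  unique : ∀ {x} → LPFeasible x → optimum ≤ lpValue x → x ≗ x̂
  unique {x} x-feas optimum≤ = λ where
      0F → x₀≡1
      1F → x₁≡1
      2F → x₂≡½
      3F → x₃≡½
    where
    slacks≡0 : (½ * capacitySlack x + colorSlack x) + (P-3/2 * (1ℚ ⊖ x 0F) + P-3/2 * (1ℚ ⊖ x 1F)) ≡ 0ℚ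
    slacks≡0 = trans (sym (duality x)) (trans
      (cong (optimum ⊖_) (ℚ.≤-antisym (lpValue≤optimum x-feas) optimum≤)) (ℚ.+-inverseʳ optimum))
    rows≡0 : (½ * capacitySlack x + colorSlack x ≡ 0ℚ) × (P-3/2 * (1ℚ ⊖ x 0F) + P-3/2 * (1ℚ ⊖ x 1F) ≡ 0ℚ)
    rows≡0 = +≡0 (0≤+ (0≤capacity x-feas) (0≤color x-feas))
                 (0≤+ (0≤bound x-feas 0F) (0≤bound x-feas 1F)) slacks≡0
    capacity≡0 : capacitySlack x ≡ 0ℚ
    capacity≡0 = *-zero-cancelˡ {½} (λ ()) (proj₁ (+≡0 (0≤capacity x-feas) (0≤color x-feas) (proj₁ rows≡0)))
    color≡0 : colorSlack x ≡ 0ℚ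
    color≡0 = proj₂ (+≡0 (0≤capacity x-feas) (0≤color x-feas) (proj₁ rows≡0))
    bounds≡0 : (P-3/2 * (1ℚ ⊖ x 0F) ≡ 0ℚ) × (P-3/2 * (1ℚ ⊖ x 1F) ≡ 0ℚ)
    bounds≡0 = +≡0 (0≤bound x-feas 0F) (0≤bound x-feas 1F) (proj₂ rows≡0)
    1-x≡0⇒x≡1 : ∀ {q} → P-3/2 * (1ℚ ⊖ q) ≡ 0ℚ → q ≡ 1ℚ
    1-x≡0⇒x≡1 {q} eq = p-q≡0⇒q≡p (*-zero-cancelˡ (λ P-3/2≡0 → ℚ.<⇒≢ 0<P-3/2 (sym P-3/2≡0)) eq)
    x₀≡1 : x 0F ≡ 1ℚ
    x₀≡1 = 1-x≡0⇒x≡1 (proj₁ bounds≡0)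
    x₁≡1 : x 1F ≡ 1ℚ
    x₁≡1 = 1-x≡0⇒x≡1 (proj₂ bounds≡0)
    x₂≡½ : x 2F ≡ ½
    x₂≡½ = trans
      -- Adding `P` times the colour slack to half the capacity slack eliminates `x₃` and leaves
      -- `x₂` with coefficient -1.
      (solve 5 (λ P x₀ x₁ x₂ x₃ → x₂ :=
        (con ½ :+ (con ½ :+ P) :* ((con 1ℚ :- x₀) :+ (con 1ℚ :- x₁))) :-
        (P :* (con 1ℚ :- ((x₀ :+ (x₁ :+ (con 0ℚ :+ (con 0ℚ :+ con 0ℚ)))) :-
                    (con 0ℚ :+ (con 0ℚ :+ (x₂ :+ (x₃ :+ con 0ℚ)))))) :+
         con ½ :* ((P :+ P :+ con 3ℚ) :- (con 1ℚ :* x₀ :+ (con 1ℚ :* x₁ :+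
          ((P :+ P :+ con 2ℚ) :* x₂ :+ ((P :+ P) :* x₃ :+ con 0ℚ)))))))
        refl P (x 0F) (x 1F) (x 2F) (x 3F))
      (trans (cong₂ (λ u v → (½ + (½ + P) * u) ⊖ v)
          (cong₂ (λ y z → (1ℚ ⊖ y) + (1ℚ ⊖ z)) x₀≡1 x₁≡1)
          (cong₂ (λ c d → P * c + ½ * d) color≡0 capacity≡0))
        (solve 1 (λ P → (con ½ :+ (con ½ :+ P) :* ((con 1ℚ :- con 1ℚ) :+ (con 1ℚ :- con 1ℚ))) :-
                        (P :* con 0ℚ :+ con ½ :* con 0ℚ) := con ½) refl P))
    x₃≡½ : x 3F ≡ ½
    x₃≡½ = trans
      (solve 4 (λ x₀ x₁ x₂ x₃ → x₃ := ((x₀ :+ x₁) :- (con 1ℚ :+ x₂)) :+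
        (con 1ℚ :- ((x₀ :+ (x₁ :+ (con 0ℚ :+ (con 0ℚ :+ con 0ℚ)))) :-
                    (con 0ℚ :+ (con 0ℚ :+ (x₂ :+ (x₃ :+ con 0ℚ))))))) refl
        (x 0F) (x 1F) (x 2F) (x 3F))
      (cong₂ _+_ (cong₂ _⊖_ (cong₂ _+_ x₀≡1 x₁≡1) (cong (λ q → 1ℚ + q) x₂≡½)) color≡0)

  x̂-feasible : LPFeasible x̂
  x̂-feasible = record
    { capacity = ℚ.≤-reflexive (trans (load≡ x̂) (trans
        (solve 1 (λ P → con 1ℚ :* con 1ℚ :+ (con 1ℚ :* con 1ℚ :+ ((P :+ P :+ con 2ℚ) :* con ½ :+
                          ((P :+ P) :* con ½ :+ con 0ℚ))) := P :+ P :+ con 3ℚ) refl P) (sym b≡)))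
    ; color    = λ where
        0F → from-yes (sumOverℚ (items 0F) x̂ ⊖ sumOverℚ (∁ (items 0F)) x̂ ℚ.≤? 1ℚ)
        1F → from-yes (sumOverℚ (items 1F) x̂ ⊖ sumOverℚ (∁ (items 1F)) x̂ ℚ.≤? 1ℚ)
    ; nonneg   = λ where
        0F → 0≤1
        1F → 0≤1
        2F → ℚ.nonNegative⁻¹ ½
        3F → ℚ.nonNegative⁻¹ ½
    ; atMost1  = λ where
        0F → ℚ.≤-refl
        1F → ℚ.≤-refl
        2F → from-yes (½ ℚ.≤? 1ℚ)
        3F → from-yes (½ ℚ.≤? 1ℚ)
    }
    where
    0≤1 : 0ℚ ≤ 1ℚ
    0≤1 = ℚ.<⇒≤ 0<1

  lpValue-x̂ : lpValue x̂ ≡ optimum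
  lpValue-x̂ = trans (lpValue≡ x̂)
    (solve 1 (λ P → P :* con 1ℚ :+ (P :* con 1ℚ :+ (P :* con ½ :+ ((P :- con 1ℚ) :* con ½ :+ con 0ℚ))) :=
                    P :+ P :+ P :- con ½) refl P)

  x̂-optimal : LPOptimal x̂
  x̂-optimal = x̂-feasible , λ y y-feas → subst (lpValue y ≤_) (sym lpValue-x̂) (lpValue≤optimum y-feas)

  -- A unique optimum is extreme: if `x̂` is a proper convex combination of `y` and `z`, their gaps
  -- to the optimum average to 0, so both are optimal and both equal `x̂`.
  x̂-extreme : LPExtreme x̂
  x̂-extreme = x̂-feasible , λ y z t y-feas z-feas 0<t t<1 x̂≗ →
    let sy = optimum ⊖ lpValue y
        sz = optimum ⊖ lpValue z
        combination : lpValue x̂ ≡ t * lpValue y + (1ℚ ⊖ t) * lpValue z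
        combination = trans (·-congʳ pℚ x̂≗) (trans (·-+ pℚ (λ i → t * y i) (λ i → (1ℚ ⊖ t) * z i))
                              (cong₂ _+_ (·-* pℚ t y) (·-* pℚ (1ℚ ⊖ t) z)))
        slack≡0 : t * sy + (1ℚ ⊖ t) * sz ≡ 0ℚ
        slack≡0 = trans
          (solve 4 (λ o t y z → t :* (o :- y) :+ (con 1ℚ :- t) :* (o :- z) :=
                                o :- (t :* y :+ (con 1ℚ :- t) :* z)) refl optimum t (lpValue y) (lpValue z))
          (trans (cong (optimum ⊖_) (trans (sym combination) lpValue-x̂)) (ℚ.+-inverseʳ optimum))
        both≡0 = +≡0 (0≤* (ℚ.<⇒≤ 0<t) (0≤q-p (lpValue≤optimum y-feas)))
                     (0≤* (ℚ.<⇒≤ (0<q-p t<1)) (0≤q-p (lpValue≤optimum z-feas))) slack≡0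
        sy≡0 = *-zero-cancelˡ (λ t≡0 → ℚ.<⇒≢ 0<t (sym t≡0)) (proj₁ both≡0)
        sz≡0 = *-zero-cancelˡ (λ 1-t≡0 → ℚ.<⇒≢ (0<q-p t<1) (sym 1-t≡0)) (proj₂ both≡0)
        y≗x̂ = unique y-feas (ℚ.≤-reflexive (sym (p-q≡0⇒q≡p sy≡0)))
        z≗x̂ = unique z-feas (ℚ.≤-reflexive (sym (p-q≡0⇒q≡p sz≡0)))
    in λ i → trans (y≗x̂ i) (sym (z≗x̂ i))

  rounded-up : Subset 4
  rounded-up = inside ∷ inside ∷ outside ∷ outside ∷ []

  not-color-feasible : ¬ ColorFeasible rounded-up
  -- Both rounded items have colour 0, so the test is `2 * 2 ≤ 2 + 1`.
  not-color-feasible = from-no (4 ℕ.≤? 3)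

  repair≤N : ∀ {T S₀} → T ≡ rounded-up → Repair T S₀ → profit S₀ ℤ.≤ + N
  repair≤N refl (keep feas) = contradiction feas not-color-feasible
  repair≤N refl (remove c j _ _ j∈ _) = removed j (Subset.p∩q⊆p rounded-up (items c) j∈)
    where
    removed : ∀ j → j ∈ rounded-up → profit (rounded-up - j) ℤ.≤ + N
    removed 0F _ = ℤ.≤-reflexive (trans (ℤ.+-identityˡ _) (ℤ.+-identityʳ (+ N)))
    removed 1F _ = ℤ.≤-reflexive (ℤ.+-identityʳ (+ N))
    removed 2F (there (there ()))
    removed 3F (there (there (there ())))

  -- Uniqueness of the LP optimum forces every run to round `x̂`, whatever its choices; hence the
  -- bound is independent of tie-breaking.
  LPRound⇒profit≤N : ∀ {Ŝ} → LPRound Ŝ → profit Ŝ ℤ.≤ + N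
  LPRound⇒profit≤N run = from-choice returned
    where
    open LPRound run
    x*≗x̂ : x* ≗ x̂
    x*≗x̂ = unique (proj₁ optimal) (subst (_≤ lpValue x*) lpValue-x̂ (proj₂ optimal x̂ x̂-feasible))
    ones≡ : ones x* ≡ rounded-up
    ones≡ = tabulate-cong (λ i → cong (λ q → does (q ℚ.≟ 1ℚ)) (x*≗x̂ i))
    from-choice : ∀ {S} → MoreProfitableOf S₀ ⁅ r ⁆ S → profit S ℤ.≤ + N
    from-choice (inj₁ (refl , _)) = repair≤N ones≡ rounded
    from-choice (inj₂ (refl , _)) = subst (ℤ._≤ + N) (sym (sumOverℤ-⁅⁆ r p)) (p≤N r)

  moreProfitable : ∀ S T → ∃[ Ŝ ] MoreProfitableOf S T Ŝ
  moreProfitable S T with ℤ.≤-total (profit T) (profit S)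
  ... | inj₁ T≤S = S , inj₁ (refl , T≤S)
  ... | inj₂ S≤T = T , inj₂ (refl , S≤T)

  -- An explicit run is needed for the ratio to be realised at all; here item `0F` is removed, one
  -- of two items tied for the minimum.
  run : ∃[ Ŝ ] LPRound Ŝ
  run = proj₁ choice , record
    { x* = x̂ ; optimal = x̂-optimal ; basic = x̂-extreme
    ; S₀ = rounded-up - 0F
    ; rounded = remove 0F 0F not-color-feasible refl here (λ where
        0F _ → ℤ.≤-refl
        1F _ → ℤ.≤-refl
        2F (there (there ()))
        3F (there (there (there ()))))
    ; r = 0F
    ; r-max = p≤N
    ; returned = proj₂ choice
    }
    where
    choice : ∃[ Ŝ ] MoreProfitableOf (rounded-up - 0F) ⁅ 0F ⁆ Ŝ
    choice = moreProfitable (rounded-up - 0F) ⁅ 0F ⁆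

  best : Subset 4
  best = inside ∷ inside ∷ outside ∷ inside ∷ []

  best-feasible : Feasible best
  -- The colour test is `2 * 2 ≤ 3 + 1`, and the weight `2N + 2` is one below the capacity.
  best-feasible = from-yes (4 ℕ.≤? 4) ,
    ℕ.≤-trans (ℕ.≤-reflexive (trans (cong (2 ℕ.+_) (ℕ.+-identityʳ (N ℕ.+ N))) (ℕ.+-comm 2 (N ℕ.+ N))))
              (ℕ.+-monoʳ-≤ (N ℕ.+ N) (ℕ.n≤1+n 2))

  ιOPT≥ : P + P + P ⊖ 1ℚ ≤ ι OPT
  ιOPT≥ = ℚ.≤-trans (ℚ.≤-reflexive (trans
      (solve 1 (λ P → P :+ P :+ P :- con 1ℚ := P :+ (P :+ (con 0ℚ :+ ((P :- con 1ℚ) :+ con 0ℚ)))) refl P)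
      (trans (cong (λ q → P + (P + (0ℚ + (q + 0ℚ)))) (sym (ι-+ (+ N) (ℤ.- (+ 1)))))
             (sym (ι-sumOverℤ best p)))))
    (ι-mono-≤ (OPT-upper best best-feasible))

  -- After multiplication by `OPT` the claim follows from `OPT ≥ 3N - 1`, a returned profit of at
  -- most `N`, and `ε * OPT ≥ 1`. The last covers the loss of a third and leaves a margin of two
  -- thirds.
  ratio<⅓+ε : ∀ ε → 0ℚ < ε → ℚ.↧ₙ ε ℕ.≤ N → ∀ {Ŝ} → LPRound Ŝ → ratio admissible Ŝ < + 1 / 3 + ε
  ratio<⅓+ε ε 0<ε ↧ε≤N {Ŝ} run = ℚ.*-cancelʳ-<-nonNeg O {{ℚ.nonNegative (ℚ.<⇒≤ 0<O)}}
    (ℚ.≤-<-trans (ℚ.≤-reflexive ratio*O)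
      (<-certificate
        (solve 5 (λ O e D z P → (con (+ 1 / 3) :+ e) :* O :- z :=
            con (+ 2 / 3) :+ (con (+ 1 / 3) :* (O :- (P :+ P :+ P :- con 1ℚ)) :+ ((P :- z) :+
              ((e :* D :- con 1ℚ) :+ e :* (O :- D))))) refl O ε D (ι (profit Ŝ)) P)
        (0<+ (ℚ.positive⁻¹ (+ 2 / 3)) (0≤+ (0≤* (ℚ.nonNegative⁻¹ (+ 1 / 3)) (0≤q-p ιOPT≥))
          (0≤+ (0≤q-p (ι-mono-≤ (LPRound⇒profit≤N run)))
            (0≤+ (0≤q-p (1≤ε*↧ε ε 0<ε)) (0≤* (ℚ.<⇒≤ 0<ε) (0≤q-p D≤O))))))))
    where
    O D : ℚ
    O = ι OPT
    D = ι (+ ℚ.↧ₙ ε)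
    0<O : 0ℚ < O
    0<O = ι-mono-< (OPT>0 admissible)
    D≤O : D ≤ O
    -- The chain is `D ≤ P ≤ 3P - 1 ≤ O`; its middle step needs `P ≥ 1`.
    D≤O = ℚ.≤-trans (ι-mono-≤ (ℤ.+≤+ ↧ε≤N)) (ℚ.≤-trans
      (≤-certificate (solve 1 (λ P → (P :+ P :+ P :- con 1ℚ) :- P := (P :- con 1ℚ) :+ P) refl P)
        (0≤+ (0≤q-p (ι-mono-≤ {+ 1} (ℤ.+≤+ (ℕ.≤-trans (ℕ.s≤s ℕ.z≤n) 2≤N)))) (ι-mono-≤ {+ 0} {+ N} (ℤ.+≤+ ℕ.z≤n))))
      ιOPT≥)
    ratio*O : ratio admissible Ŝ * O ≡ ι (profit Ŝ)
    ratio*O = trans (cong (λ z → ratio admissible Ŝ * ι z) (sym (ℤ.0≤i⇒+∣i∣≡i (ℤ.<⇒≤ (OPT>0 admissible)))))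
                    (/-*-ι (profit Ŝ) ℤ.∣ OPT ∣ {{_}})

-- The infimum over all runs and under each tie-breaking rule

runRatio-infimum : IsInfimum RunRatio (+ 1 / 3)
runRatio-infimum =
  (λ { x ((I , adm) , Ŝ , run , refl) → LowerBound.⅓≤ratio I adm run }) ,
  -- This `N` is at least 2 and at least the denominator of `ε`.
  λ ε 0<ε → let open Family (2 ℕ.+ ℚ.↧ₙ ε) (ℕ.m≤m+n 2 (ℚ.↧ₙ ε)) in
    ColKP.ratio J admissible (proj₁ run) ,
    ((J , admissible) , proj₁ run , proj₂ run , refl) ,
    ratio<⅓+ε ε 0<ε (ℕ.m≤n+m (ℚ.↧ₙ ε) 2) (proj₂ run)

-- Both bounds hold for every run on the instances in question, so they apply to the run that `A`
-- selects.
ruleRatio-infimum : ∀ A → IsInfimum (RuleRatio A) (+ 1 / 3)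
ruleRatio-infimum A =
  (λ { x ((I , adm) , refl) → LowerBound.⅓≤ratio I adm (proj₂ (A (I , adm))) }) ,
  λ ε 0<ε → let open Family (2 ℕ.+ ℚ.↧ₙ ε) (ℕ.m≤m+n 2 (ℚ.↧ₙ ε)) in
    ColKP.ratio J admissible (proj₁ (A (J , admissible))) ,
    ((J , admissible) , refl) ,
    ratio<⅓+ε ε 0<ε (ℕ.m≤n+m (ℚ.↧ₙ ε) 2) (proj₂ (A (J , admissible)))

corollary3p2 : IsInfimum RunRatio (+ 1 / 3) × (∀ (A : LPRoundRule) → IsInfimum (RuleRatio A) (+ 1 / 3))
corollary3p2 = runRatio-infimum , ruleRatio-infimum
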